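{- There is a universal constant $K>0$ such that the following holds. Let $I=(F_1,\dots,F_n)$ be an instance, let $s\in\{1,\dots,n\}$, let $G=\big(\prod_{i=1}^sF_i\big)^{1/s}$, and define the instance $I'=(G,G,\dots,G,F_{s+1},F_{s+2},\dots,F_n)$ (with $s$ copies of $G$). If $s\ge n/2$ and, for a given $\varepsilon>1/\sqrt n$, all distributions $F_i$ with $i\le s$ are $\varepsilon$-small, then for any deterministic algorithm $ALG$ (a sequence of thresholds) and any permutation $\sigma$ of $\{1,\dots,n\}$, $$\mathbb{E}\big(ALG(I_\rho,\sigma)\big)\ \ge\ \mathbb{E}\big(ALG(I',\sigma)\big)-K\varepsilon\cdot\mathbb{E}\Big(\max_{1\le i\le n}X_i\Big),$$ where $X_1\sim F_1,\dots,X_n\sim F_n$ are independent and $\rho$ is an independent random permutation of $\{1,\dots,n\}$ that restricted to the first $s$ indices is a uniformly random permutation of $\{1,\dots,s\}$ and equals the identity on indices $i>s$.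
   Context: An instance is a tuple of cumulative distribution functions of nonnegative random variables. A distribution $F$ is $\varepsilon$-small if a variable drawn from $F$ is larger than zero with probability at most $\varepsilon$ (equivalently equals $0$ with probability at least $1-\varepsilon$). A deterministic algorithm is a sequence of thresholds $\tau_1,\dots,\tau_n\ge0$. For an instance $J=(J_1,\dots,J_n)$ and a permutation $\sigma$ of $\{1,\dots,n\}$, $ALG(J,\sigma)$ is the reward obtained as follows: draw independent $Z_1\sim J_1,\dots,Z_n\sim J_n$, present them in the order $Z_{\sigma(1)},\dots,Z_{\sigma(n)}$, and pick the first $Z_{\sigma(t)}$ with $Z_{\sigma(t)}>\tau_t$; the reward is the picked value ($0$ if none is picked). $I_\rho$ is the instance obtained by reordering $I$ according to $\rho$, i.e. $I_\rho=(F_{\rho(1)},\dots,F_{\rho(n)})$; the expectation of $ALG(I_\rho,\sigma)$ is also over $\rho$. -}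

module Defs where

open import Level using (0ℓ; suc)
open import Algebra.Bundles using (CommutativeRing)
open import Axiom.ExcludedMiddle using (ExcludedMiddle)
open import Data.Bool.Base using (if_then_else_)
open import Data.Fin.Base as Fin using (Fin; toℕ; inject≤)
open import Data.Fin.Permutation as Perm using (Permutation′; _⟨$⟩ʳ_)
open import Data.Nat.Base as ℕ using (ℕ; _!)
import Data.Nat.Properties as ℕ
open import Data.Product.Base using (Σ; ∃; _×_; _,_)
open import Data.Vec.Functional using (Vector; head; tail; foldr)
open import Function.Base using (_∘_)
open import Relation.Binary.Bundles using (DecTotalOrder)
open import Relation.Binary.Core using (Rel)
open import Relation.Binary.PropositionalEquality.Core using (_≡_; _≢_)
open import Relation.Binary.Structures using (IsDecTotalOrder)
open import Relation.Nullary using (¬_; does; yes; no)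
open import Relation.Unary using (Pred; _∈_; _⊥_; _≐_; _∩_; ∁; ⋃; U; Satisfiable)

module _ {A : Set} (_≤_ : Rel A 0ℓ) where

  BoundedAbove : Pred A (suc 0ℓ) → Set (suc 0ℓ)
  BoundedAbove S = ∃ λ b → ∀ {x} → x ∈ S → x ≤ b

  record IsLub (S : Pred A (suc 0ℓ)) (l : A) : Set (suc 0ℓ) where
    field
      upper : ∀ {x} → x ∈ S → x ≤ l
      least : ∀ {b} → (∀ {x} → x ∈ S → x ≤ b) → l ≤ b

-- The library has no real numbers, so they enter axiomatically, as a
-- (Dedekind-)complete ordered field; classically this determines them up to
-- isomorphism.  Equality is a setoid equality, so that concrete
-- constructions by Cauchy sequences are models.
record RealField : Set (suc (suc 0ℓ)) where
  infix 4 _≤_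
  infix 8 _⁻¹
  field
    commutativeRing : CommutativeRing 0ℓ 0ℓ
  open CommutativeRing commutativeRing public
    using (Carrier; _≈_; _+_; _*_; -_; _-_; 0#; 1#)
  field
    _≤_             : Rel Carrier 0ℓ
    isDecTotalOrder : IsDecTotalOrder _≈_ _≤_
    +-monoˡ-≤       : ∀ z {x y} → x ≤ y → x + z ≤ y + z
    *-nonNegative   : ∀ {x y} → 0# ≤ x → 0# ≤ y → 0# ≤ x * y
    0≉1             : ¬ 0# ≈ 1#
    _⁻¹             : Carrier → Carrier
    ⁻¹-inverse      : ∀ {x} → ¬ x ≈ 0# → x * x ⁻¹ ≈ 1#
    complete        : (S : Pred Carrier (suc 0ℓ)) →
                      Satisfiable S → BoundedAbove _≤_ S → Σ Carrier (IsLub _≤_ S)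

module Real (R : RealField) where

  open RealField R public renaming (Carrier to ℝ)
  open CommutativeRing commutativeRing using (semiring; +-monoid; *-monoid)

  decTotalOrder : DecTotalOrder 0ℓ 0ℓ 0ℓ
  decTotalOrder = record { isDecTotalOrder = isDecTotalOrder }

  open DecTotalOrder decTotalOrder using (totalOrder)
  open import Relation.Binary.Properties.DecTotalOrder decTotalOrder public
    using (_<_; <-strictTotalOrder)
  open import Relation.Binary.Bundles using (StrictTotalOrder)
  open StrictTotalOrder <-strictTotalOrder public using (_<?_)
  open import Algebra.Construct.NaturalChoice.Max totalOrder public using (_⊔_)
  open import Algebra.Properties.Semiring.Exp semiring public using (_^_)
  open import Algebra.Properties.Monoid.Mult +-monoid using () renaming (_×_ to _·_)
  open import Algebra.Properties.Monoid.Sum +-monoid public using () renaming (sum to ∑)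
  open import Algebra.Properties.Monoid.Sum *-monoid public using () renaming (sum to ∏)

  fromℕ : ℕ → ℝ
  fromℕ n = n · 1#

  record IsRoot (k : ℕ) (y r : ℝ) : Set where
    field
      nonNegative : 0# ≤ r
      power       : r ^ k ≈ y

  -- Only used for families of nonnegative numbers, where starting from 0#
  -- does not change the maximum.
  maximum : ∀ {n} → Vector ℝ n → ℝ
  maximum = foldr _⊔_ 0#

  ConvergesTo : (ℕ → ℝ) → ℝ → Set
  ConvergesTo a l = ∀ δ → 0# < δ →
    ∃ λ N → ∀ m → N ℕ.≤ m → (l - δ < a m) × (a m < l + δ)

  -- The Borel σ-algebra of ℝ.
  data Borel : Pred ℝ 0ℓ → Set (suc 0ℓ) where
    half-line  : ∀ a → Borel (_≤ a)
    complement : ∀ {B} → Borel B → Borel (∁ B)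
    union      : ∀ {B : ℕ → Pred ℝ 0ℓ} → (∀ k → Borel (B k)) → Borel (⋃ ℕ B)
    respects   : ∀ {B C} → B ≐ C → Borel B → Borel C

  -- Cumulative distribution functions of nonnegative random variables.
  record IsCDF (F : ℝ → ℝ) : Set where
    field
      monotone         : ∀ {x y} → x ≤ y → F x ≤ F y
      right-continuous : ∀ x δ → 0# < δ →
                         ∃ λ η → (0# < η) × (∀ y → x ≤ y → y < x + η → F y < F x + δ)
      at-most-one      : ∀ x → F x ≤ 1#
      limit-one        : ∀ δ → 0# < δ → ∃ λ M → ∀ y → M ≤ y → 1# - δ < F y
      zero-on-negative : ∀ {x} → x < 0# → F x ≈ 0#

  Instance : ℕ → Set
  Instance n = Vector (ℝ → ℝ) n

  IsInstance : ∀ {n} → Instance n → Set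
  IsInstance I = ∀ i → IsCDF (I i)

  Small : ℝ → (ℝ → ℝ) → Set
  Small ε F = 1# - F 0# ≤ ε

  reorder : ∀ {n} → Instance n → Permutation′ n → Instance n
  reorder I π i = I (π ⟨$⟩ʳ i)

  -- Indices are 0-based: "the first s indices" are those with toℕ i < s.
  replaceFirst : ∀ {n} → ℕ → (ℝ → ℝ) → Instance n → Instance n
  replaceFirst s G I i = if does (toℕ i ℕ.<? s) then G else I i

  productFirst : ∀ {n} s → s ℕ.≤ n → Instance n → ℝ → ℝ
  productFirst s s≤n I x = ∏ {s} (λ i → I (inject≤ i s≤n) x)

  firstAbove : ∀ {m} → Vector ℝ m → Vector ℝ m → ℝ
  firstAbove {ℕ.zero}  τ v = 0#
  firstAbove {ℕ.suc m} τ v =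
    if does (head τ <? head v) then head v else firstAbove (tail τ) (tail v)

  reward : ∀ {n} → Vector ℝ n → Permutation′ n → Vector ℝ n → ℝ
  reward τ σ z = firstAbove τ (λ t → z (σ ⟨$⟩ʳ t))

  -- ℙ is a total function for convenience; nothing is assumed about its
  -- values on non-measurable sets.
  record ProbabilitySpace : Set (suc (suc 0ℓ)) where
    field
      Ω            : Set
      Measurable   : Pred Ω 0ℓ → Set (suc 0ℓ)
      m-resp       : ∀ {A B} → A ≐ B → Measurable A → Measurable B
      m-universe   : Measurable U
      m-complement : ∀ {A} → Measurable A → Measurable (∁ A)
      m-union      : ∀ {A : ℕ → Pred Ω 0ℓ} → (∀ k → Measurable (A k)) → Measurable (⋃ ℕ A)

      ℙ             : Pred Ω 0ℓ → ℝ
      ℙ-cong        : ∀ {A B} → Measurable A → A ≐ B → ℙ A ≈ ℙ B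
      ℙ-nonNegative : ∀ {A} → Measurable A → 0# ≤ ℙ A
      ℙ-universe    : ℙ U ≈ 1#
      ℙ-additive    : ∀ {A : ℕ → Pred Ω 0ℓ} → (∀ k → Measurable (A k)) →
                      (∀ j k → j ≢ k → A j ⊥ A k) →
                      ConvergesTo (λ N → ∑ {N} (λ k → ℙ (A (toℕ k)))) (ℙ (⋃ ℕ A))

  module Probability (P : ProbabilitySpace) where

    open ProbabilitySpace P public

    ℙ[_∣_] : Pred Ω 0ℓ → Pred Ω 0ℓ → ℝ
    ℙ[ A ∣ C ] = ℙ (A ∩ C) * ℙ C ⁻¹

    -- Under the probability Q on Ω (in practice ℙ or a conditional
    -- probability), Z₁, …, Zₙ are independent nonnegative random variables
    -- with Zᵢ ∼ Jᵢ.
    record IsDraw {n} (Q : Pred Ω 0ℓ → ℝ) (J : Instance n) (Z : Vector (Ω → ℝ) n)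
                  : Set (suc 0ℓ) where
      field
        nonNegative : ∀ i ω → 0# ≤ Z i ω
        measurable  : ∀ i {B} → Borel B → Measurable (λ ω → Z i ω ∈ B)
        law         : ∀ i x → Q (λ ω → Z i ω ≤ x) ≈ J i x
        independent : ∀ (B : Vector (Pred ℝ 0ℓ) n) → (∀ i → Borel (B i)) →
                      Q (λ ω → ∀ i → Z i ω ∈ B i) ≈ ∏ (λ i → Q (λ ω → Z i ω ∈ B i))

    [_≔_] : ∀ {n} → (Ω → Permutation′ n) → Permutation′ n → Pred Ω 0ℓ
    [ ρ ≔ π ] ω = ρ ω Perm.≈ π

    FixesFrom : ∀ {n} → ℕ → Permutation′ n → Set
    FixesFrom s π = ∀ i → s ℕ.≤ toℕ i → π ⟨$⟩ʳ i ≡ i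

    record IsUniformOnFirst {n} (s : ℕ) (ρ : Ω → Permutation′ n) : Set (suc 0ℓ) where
      field
        measurable : ∀ π → Measurable [ ρ ≔ π ]
        fixes-rest : ∀ ω → FixesFrom s (ρ ω)
        uniform    : ∀ π → FixesFrom s π → ℙ [ ρ ≔ π ] ≈ fromℕ (s !) ⁻¹

    Independent : ∀ {n} → Vector (Ω → ℝ) n → (Ω → Permutation′ n) → Set (suc 0ℓ)
    Independent {n} X ρ = ∀ (B : Vector (Pred ℝ 0ℓ) n) → (∀ i → Borel (B i)) → ∀ π →
      ℙ ((λ ω → ∀ i → X i ω ∈ B i) ∩ [ ρ ≔ π ]) ≈ ℙ (λ ω → ∀ i → X i ω ∈ B i) * ℙ [ ρ ≔ π ]

    -- Z is a draw from the randomly reordered instance I_ρ: given ρ = π, the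
    -- Zᵢ are independent with Zᵢ ∼ F_{π(i)}.
    IsReorderedDraw : ∀ {n} → Instance n → (Ω → Permutation′ n) → Vector (Ω → ℝ) n → Set (suc 0ℓ)
    IsReorderedDraw I ρ Z = ∀ π → 0# < ℙ [ ρ ≔ π ] →
      IsDraw (λ A → ℙ[ A ∣ [ ρ ≔ π ] ]) (reorder I π) Z

    -- A nonnegative simple function ∑ₖ cₖ·1_{Aₖ} with disjoint Aₖ (it is 0
    -- outside their union) that lies below f.
    record SimpleBelow (f : Ω → ℝ) : Set (suc 0ℓ) where
      field
        size        : ℕ
        set         : Vector (Pred Ω 0ℓ) size
        coefficient : Vector ℝ size
        measurable  : ∀ k → Measurable (set k)
        disjoint    : ∀ j k → j ≢ k → set j ⊥ set k
        nonNegative : ∀ k → 0# ≤ coefficient k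
        below       : ∀ k {ω} → ω ∈ set k → coefficient k ≤ f ω

      integral : ℝ
      integral = ∑ (λ k → coefficient k * ℙ (set k))

    LowerIntegrals : (Ω → ℝ) → Pred ℝ (suc 0ℓ)
    LowerIntegrals f v = Σ (SimpleBelow f) λ φ → SimpleBelow.integral φ ≈ v

    FiniteExpectation : (Ω → ℝ) → Set (suc 0ℓ)
    FiniteExpectation f = BoundedAbove _≤_ (LowerIntegrals f)

    lowerIntegrals-nonempty : ∀ f → Satisfiable (LowerIntegrals f)
    lowerIntegrals-nonempty f = 0# , record
      { size = 0 ; set = λ () ; coefficient = λ () ; measurable = λ ()
      ; disjoint = λ () ; nonNegative = λ () ; below = λ () } , refl
      where open CommutativeRing commutativeRing using (refl)

    -- The Lebesgue integral of a nonnegative measurable function, with the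
    -- junk value 0# when the integral is infinite.
    𝔼 : ExcludedMiddle (suc 0ℓ) → (Ω → ℝ) → ℝ
    𝔼 em f with em {FiniteExpectation f}
    ... | no _ = 0#
    ... | yes bounded with complete (LowerIntegrals f) (lowerIntegrals-nonempty f) bounded
    ...   | e , _ = e

{-# OPTIONS --safe #-}
module Submission where

-- For every x ≥ 0 one has ℙ(ALG(I_ρ) > x) ≥ (1-ε)² ℙ(ALG(I′) > x), and integrating over x gives K = 2, because
-- (1-ε)² ≥ 1-2ε and ALG(I′) is dominated by a maximum with the law of max Xᵢ.  The tail bound is shown separately
-- for each time t at which the algorithm stops.  By AM-GM over all permutations,
--   E_ρ ∏_{r<t} F_{ρσ(r)}(τ_r) ≥ ∏_{r<t} G(τ_r),
-- and conditioning on ρσ(t) = i costs only a factor 1-ε, since ∏_{j≠i} F_j ≥ Gˢ ≥ (1-ε) Gˢ⁻¹.  A second use of AM-GM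
-- gives (1/s) ∑ᵢ (1-Fᵢ) ≥ (1-ε) (1-G), which accounts for the other factor 1-ε.

open import Defs
open import Algebra.Bundles using (CommutativeMonoid; CommutativeRing; RawRing)
import Algebra.Construct.NaturalChoice.Max
import Algebra.Properties.CommutativeMonoid.Sum
import Algebra.Properties.CommutativeSemiring.Exp
import Algebra.Properties.Ring
import Algebra.Properties.Semiring.Mult
import Algebra.Properties.Semiring.Sum
import Algebra.Solver.Ring
import Algebra.Solver.Ring.AlmostCommutativeRing as ACR
open import Axiom.ExcludedMiddle using (ExcludedMiddle)
open import Data.Bool.Base using (if_then_else_; true; false)
open import Data.Empty using (⊥-elim-irr)
open import Data.Fin.Base as Fin using (Fin; toℕ; inject≤; punchIn; remQuot; combine; _↑ˡ_; _↑ʳ_)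
open import Data.Fin.Permutation as Perm using (Permutation′; _⟨$⟩ʳ_; _⟨$⟩ˡ_)
import Data.Fin.Properties as Fin
open import Data.List.Base using (List; []; _∷_; tabulate)
open import Data.List.Membership.Propositional using () renaming (_∈_ to _∈ˡ_)
open import Data.List.Membership.Propositional.Properties using (∈-tabulate⁺)
open import Data.List.Relation.Binary.Permutation.Propositional using (↭-sym)
open import Data.List.Relation.Binary.Permutation.Propositional.Properties using (∈-resp-↭; All-resp-↭)
open import Data.List.Relation.Unary.All as All using (All)
import Data.List.Relation.Unary.All.Properties as All
open import Data.List.Relation.Unary.Any using (here; there)
open import Data.List.Relation.Unary.Linked as Linked using (Linked; [-])
open import Data.List.Relation.Unary.Linked.Properties using (Linked⇒All)
import Data.List.Sort
open import Data.Maybe.Base using (Maybe; just; nothing)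
open import Data.Nat.Base as ℕ using (ℕ; _!)
import Data.Nat.Properties as ℕ
open import Data.Product.Base using (Σ; ∃; _×_; _,_; proj₁; proj₂)
open import Data.Sum.Base using (_⊎_; inj₁; inj₂)
open import Data.Unit.Base using (tt)
open import Data.Vec.Functional using (Vector; head; tail; replicate)
open import Function.Base using (_∘_; _$_; const)
open import Level using (0ℓ)
open import Relation.Binary.Bundles using (DecTotalOrder)
import Relation.Binary.Properties.DecTotalOrder
open import Relation.Binary.PropositionalEquality as ≡ using (_≡_; _≢_)
import Relation.Binary.Reasoning.PartialOrder
open import Relation.Nullary using (¬_; Dec; yes; no; contradiction; does)
open import Relation.Nullary.Decidable using (dec-true; dec-false)
open import Relation.Unary using (Pred; _∈_; _⊆_; _⊥_; _≐_; _∩_; _∪_; ∁; ⋃; U; ∅)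

-- The obstacle is dependence: after shuffling, the slots share the distributions without
-- replacement. Fixing the stopping time turns the event into a box, whose probability given ρ is a
-- product, so that its average over ρ is a permanent divided by a factorial. Slots that only have
-- to stay below a bound compare well with `G`: over all permutations a shuffled slot meets each
-- distribution equally often, so the geometric mean over the permutations is exactly a product of
-- values of `G`. The stopping slot is the one condition of the opposite kind, and therefore its
-- distribution is fixed first. The others then face s-1 distributions whose geometric mean is no
-- longer `G`. A factor 1-ε lost in every slot would be ruinous; but the loss affects the (s-1)-st
-- power of `G`, so each slot pays only an (s-1)-st root of it, and all of them together pay 1-ε
-- once. Expectations are suprema over simple functions, so the integration over x is carried out on
-- finite sorted lists of levels.

module OrderedField (R : RealField) where

  open Real R public
  open CommutativeRing commutativeRing public
    using (setoid; refl; sym; trans; reflexive; +-cong; +-congˡ; +-congʳ; *-cong; *-congˡ; *-congʳ; -‿cong;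
      +-comm; +-assoc; *-comm; *-assoc; +-identityˡ; +-identityʳ; *-identityˡ; *-identityʳ; zeroˡ; zeroʳ;
      ring; semiring; commutativeSemiring; +-commutativeMonoid; *-commutativeMonoid)
  open DecTotalOrder decTotalOrder public
    using (_≤?_; total; poset; antisym; ≤-respˡ-≈; ≤-respʳ-≈)
    renaming (refl to ≤-refl; reflexive to ≤-reflexive; trans to ≤-trans)
  open Relation.Binary.Properties.DecTotalOrder decTotalOrder public
    using (<-irrefl; <-respˡ-≈; <-respʳ-≈; <⇒≱)

  open Algebra.Construct.NaturalChoice.Max (DecTotalOrder.totalOrder decTotalOrder) public
    using (x≤x⊔y; x≤y⊔x; ⊔-sel; ⊔-lub)

  module Mult = Algebra.Properties.Semiring.Mult semiring
  module Exp = Algebra.Properties.CommutativeSemiring.Exp commutativeSemiring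
  module Sum = Algebra.Properties.Semiring.Sum semiring
  module Prod = Algebra.Properties.CommutativeMonoid.Sum *-commutativeMonoid
  module ≤-Reasoning = Relation.Binary.Reasoning.PartialOrder poset

  -- The ring solver is used with integer coefficients, since equality of abstract reals does not compute.
  module Solver where

    open import Data.Integer.Base as ℤ using (ℤ; +_; -[1+_]; _◃_; _⊖_; sign; ∣_∣)
    import Data.Integer.Properties as ℤ
    open import Data.Nat.Base using (zero; suc)
    open import Data.Sign.Base as Sign using (Sign)
    open Algebra.Properties.Ring ring
    open import Relation.Binary.Reasoning.Setoid setoid

    signed : Sign → ℝ → ℝ
    signed Sign.+ x = x
    signed Sign.- x = - x

    fromℤ : ℤ → ℝ
    fromℤ (+ n)      = fromℕ n
    fromℤ (-[1+ n ]) = - fromℕ (suc n)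

    signed-cong : ∀ s {x y} → x ≈ y → signed s x ≈ signed s y
    signed-cong Sign.+ eq = eq
    signed-cong Sign.- eq = -‿cong eq

    signed-* : ∀ s t x y → signed (s Sign.* t) (x * y) ≈ signed s x * signed t y
    signed-* Sign.+ Sign.+ x y = refl
    signed-* Sign.+ Sign.- x y = -‿distribʳ-* x y
    signed-* Sign.- Sign.+ x y = -‿distribˡ-* x y
    signed-* Sign.- Sign.- x y = begin
      x * y         ≈⟨ -‿involutive _ ⟨
      - - (x * y)   ≈⟨ -‿cong (-‿distribˡ-* x y) ⟩
      - (- x * y)   ≈⟨ -‿distribʳ-* (- x) y ⟩
      - x * - y     ∎

    fromℤ-◃ : ∀ s n → fromℤ (s ◃ n) ≈ signed s (fromℕ n)
    fromℤ-◃ Sign.+ zero    = refl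
    fromℤ-◃ Sign.- zero    = sym -0#≈0#
    fromℤ-◃ Sign.+ (suc n) = refl
    fromℤ-◃ Sign.- (suc n) = refl

    fromℤ-sign : ∀ i → fromℤ i ≈ signed (sign i) (fromℕ ∣ i ∣)
    fromℤ-sign (+ n)      = refl
    fromℤ-sign (-[1+ n ]) = refl

    fromℤ-⊖ : ∀ m n → fromℤ (m ⊖ n) ≈ fromℕ m - fromℕ n
    fromℤ-⊖ m       zero    = sym (trans (+-congˡ -0#≈0#) (+-identityʳ _))
    fromℤ-⊖ zero    (suc n) = sym (+-identityˡ _)
    fromℤ-⊖ (suc m) (suc n) = begin
      fromℤ (suc m ⊖ suc n)                   ≡⟨ ≡.cong fromℤ (ℤ.[1+m]⊖[1+n]≡m⊖n m n) ⟩
      fromℤ (m ⊖ n)                           ≈⟨ fromℤ-⊖ m n ⟩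
      fromℕ m - fromℕ n                       ≈⟨ +-identityˡ _ ⟨
      0# + (fromℕ m - fromℕ n)                ≈⟨ +-congʳ (-‿inverseʳ 1#) ⟨
      (1# - 1#) + (fromℕ m - fromℕ n)         ≈⟨ +-assoc _ _ _ ⟩
      1# + (- 1# + (fromℕ m - fromℕ n))       ≈⟨ +-congˡ (+-assoc _ _ _) ⟨
      1# + ((- 1# + fromℕ m) - fromℕ n)       ≈⟨ +-congˡ (+-congʳ (+-comm _ _)) ⟩
      1# + ((fromℕ m - 1#) - fromℕ n)         ≈⟨ +-congˡ (+-assoc _ _ _) ⟩
      1# + (fromℕ m + (- 1# - fromℕ n))       ≈⟨ +-assoc _ _ _ ⟨
      fromℕ (suc m) + (- 1# - fromℕ n)        ≈⟨ +-congˡ (-‿+-comm _ _) ⟩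
      fromℕ (suc m) - fromℕ (suc n)           ∎
      where open CommutativeRing commutativeRing using (-‿inverseʳ)

    fromℤ-+ : ∀ i j → fromℤ (i ℤ.+ j) ≈ fromℤ i + fromℤ j
    fromℤ-+ (+ m)      (+ n)      = Mult.×-homo-+ 1# m n
    fromℤ-+ (+ m)      (-[1+ n ]) = fromℤ-⊖ m (suc n)
    fromℤ-+ (-[1+ m ]) (+ n)      = trans (fromℤ-⊖ n (suc m)) (+-comm _ _)
    fromℤ-+ (-[1+ m ]) (-[1+ n ]) = begin
      - fromℕ (suc (suc (m ℕ.+ n)))          ≡⟨ ≡.cong (λ k → - fromℕ (suc k)) (ℕ.+-suc m n) ⟨
      - fromℕ (suc m ℕ.+ suc n)              ≈⟨ -‿cong (Mult.×-homo-+ 1# (suc m) (suc n)) ⟩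
      - (fromℕ (suc m) + fromℕ (suc n))      ≈⟨ -‿+-comm _ _ ⟨
      - fromℕ (suc m) - fromℕ (suc n)        ∎
      where import Data.Nat.Properties as ℕ

    fromℤ-* : ∀ i j → fromℤ (i ℤ.* j) ≈ fromℤ i * fromℤ j
    fromℤ-* i j = begin
      fromℤ (i ℤ.* j)                                          ≈⟨ fromℤ-◃ (sign i Sign.* sign j) (∣ i ∣ ℕ.* ∣ j ∣) ⟩
      signed (sign i Sign.* sign j) (fromℕ (∣ i ∣ ℕ.* ∣ j ∣))    ≈⟨ signed-cong (sign i Sign.* sign j) (Mult.×1-homo-* ∣ i ∣ ∣ j ∣) ⟩
      signed (sign i Sign.* sign j) (fromℕ ∣ i ∣ * fromℕ ∣ j ∣)  ≈⟨ signed-* (sign i) (sign j) _ _ ⟩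
      signed (sign i) (fromℕ ∣ i ∣) * signed (sign j) (fromℕ ∣ j ∣) ≈⟨ *-cong (fromℤ-sign i) (fromℤ-sign j) ⟨
      fromℤ i * fromℤ j                                        ∎

    fromℤ-neg : ∀ i → fromℤ (ℤ.- i) ≈ - fromℤ i
    fromℤ-neg (+ zero)      = sym -0#≈0#
    fromℤ-neg (+ (suc n))   = refl
    fromℤ-neg (-[1+ n ])    = sym (-‿involutive _)

    -- Sends + 1 to 1# itself rather than to fromℕ 1 = 1# + 0#, so that solver goals can mention 1#.
    ⟦_⟧ᶜ : ℤ → ℝ
    ⟦ + 1 ⟧ᶜ = 1#
    ⟦ i ⟧ᶜ   = fromℤ i

    ⟦⟧ᶜ-fromℤ : ∀ i → ⟦ i ⟧ᶜ ≈ fromℤ i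
    ⟦⟧ᶜ-fromℤ (+ 0)           = refl
    ⟦⟧ᶜ-fromℤ (+ 1)           = sym (+-identityʳ 1#)
    ⟦⟧ᶜ-fromℤ (+ suc (suc n)) = refl
    ⟦⟧ᶜ-fromℤ (-[1+ n ])      = refl

    coefficients : RawRing _ _
    coefficients = record { Carrier = ℤ ; _≈_ = _≡_ ; _+_ = ℤ._+_ ; _*_ = ℤ._*_ ; -_ = ℤ.-_ ; 0# = + 0 ; 1# = + 1 }

    target : ACR.AlmostCommutativeRing _ _
    target = ACR.fromCommutativeRing commutativeRing

    morphism : coefficients ACR.-Raw-AlmostCommutative⟶ target
    morphism = record
      { ⟦_⟧    = ⟦_⟧ᶜ
      ; +-homo = λ i j → trans (⟦⟧ᶜ-fromℤ (i ℤ.+ j)) (trans (fromℤ-+ i j) (sym (+-cong (⟦⟧ᶜ-fromℤ i) (⟦⟧ᶜ-fromℤ j))))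
      ; *-homo = λ i j → trans (⟦⟧ᶜ-fromℤ (i ℤ.* j)) (trans (fromℤ-* i j) (sym (*-cong (⟦⟧ᶜ-fromℤ i) (⟦⟧ᶜ-fromℤ j))))
      ; -‿homo = λ i → trans (⟦⟧ᶜ-fromℤ (ℤ.- i)) (trans (fromℤ-neg i) (sym (-‿cong (⟦⟧ᶜ-fromℤ i))))
      ; 0-homo = refl
      ; 1-homo = refl
      }

    coefficient≟ : ∀ i j → Maybe (⟦ i ⟧ᶜ ≈ ⟦ j ⟧ᶜ)
    coefficient≟ i j with i ℤ.≟ j
    ... | yes ≡.refl = just refl
    ... | no _       = nothing

    open Algebra.Solver.Ring coefficients target morphism coefficient≟ public
      using (solve; _:=_; _:+_; _:*_; _:-_; :-_; con; Polynomial)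

    :0 : ∀ {n} → Polynomial n
    :0 = con (+ 0)

    :1 : ∀ {n} → Polynomial n
    :1 = con (+ 1)

  open Solver using (solve; _:=_; _:+_; _:*_; _:-_; :-_; :0; :1)

  -- Order arithmetic in an ordered field.

  x-x : ∀ x → x - x ≈ 0#
  x-x x = solve 1 (λ x → x :- x := :0) refl x

  +-mono-≤ : ∀ {a b c d} → a ≤ b → c ≤ d → a + c ≤ b + d
  +-mono-≤ {a} {b} {c} {d} a≤b c≤d = ≤-trans (+-monoˡ-≤ c a≤b)
    (≤-respˡ-≈ (+-comm c b) (≤-respʳ-≈ (+-comm d b) (+-monoˡ-≤ b c≤d)))

  +-monoʳ-≤ : ∀ z {x y} → x ≤ y → z + x ≤ z + y
  +-monoʳ-≤ z = +-mono-≤ ≤-refl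

  0≤y-x : ∀ {x y} → x ≤ y → 0# ≤ y - x
  0≤y-x {x} x≤y = ≤-respˡ-≈ (x-x x) (+-monoˡ-≤ (- x) x≤y)

  0≤y-x⇒x≤y : ∀ {x y} → 0# ≤ y - x → x ≤ y
  0≤y-x⇒x≤y {x} {y} p = ≤-respˡ-≈ (+-identityˡ x)
    (≤-respʳ-≈ (solve 2 (λ x y → (y :- x) :+ x := y) refl x y) (+-monoˡ-≤ x p))

  neg-mono-≤ : ∀ {x y} → x ≤ y → - y ≤ - x
  neg-mono-≤ {x} {y} x≤y = 0≤y-x⇒x≤y
    (≤-respʳ-≈ (solve 2 (λ x y → y :- x := :- x :- :- y) refl x y) (0≤y-x x≤y))

  sub-mono-≤ : ∀ {a b c d} → a ≤ b → c ≤ d → a - d ≤ b - c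
  sub-mono-≤ a≤b c≤d = +-mono-≤ a≤b (neg-mono-≤ c≤d)

  x-y≤x : ∀ {x y} → 0# ≤ y → x - y ≤ x
  x-y≤x {x} {y} 0≤y = 0≤y-x⇒x≤y (≤-respʳ-≈ (solve 2 (λ x y → y := x :- (x :- y)) refl x y) 0≤y)

  *-monoˡ-≤ : ∀ {z x y} → 0# ≤ z → x ≤ y → z * x ≤ z * y
  *-monoˡ-≤ {z} {x} {y} 0≤z x≤y = 0≤y-x⇒x≤y
    (≤-respʳ-≈ (solve 3 (λ x y z → z :* (y :- x) := z :* y :- z :* x) refl x y z)
      (*-nonNegative 0≤z (0≤y-x x≤y)))

  *-monoʳ-≤ : ∀ {z x y} → 0# ≤ z → x ≤ y → x * z ≤ y * z
  *-monoʳ-≤ {z} {x} {y} 0≤z x≤y = ≤-respˡ-≈ (*-comm z x) (≤-respʳ-≈ (*-comm z y) (*-monoˡ-≤ 0≤z x≤y))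

  *-mono-≤ : ∀ {a b c d} → 0# ≤ a → 0# ≤ d → a ≤ b → c ≤ d → a * c ≤ b * d
  *-mono-≤ 0≤a 0≤d a≤b c≤d = ≤-trans (*-monoˡ-≤ 0≤a c≤d) (*-monoʳ-≤ 0≤d a≤b)

  <⇒≤ : ∀ {x y} → x < y → x ≤ y
  <⇒≤ = proj₁

  ≰⇒> : ∀ {x y} → ¬ x ≤ y → y < x
  ≰⇒> {x} {y} x≰y with total x y
  ... | inj₁ x≤y = contradiction x≤y x≰y
  ... | inj₂ y≤x = y≤x , λ y≈x → x≰y (≤-reflexive (sym y≈x))

  ≮⇒≥ : ∀ {x y} → ¬ x < y → y ≤ x
  ≮⇒≥ {x} {y} x≮y with y ≤? x
  ... | yes y≤x = y≤x
  ... | no y≰x  = contradiction (≰⇒> y≰x) x≮y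

  <-≤-trans : ∀ {x y z} → x < y → y ≤ z → x < z
  <-≤-trans x<y y≤z = ≰⇒> λ z≤x → <⇒≱ x<y (≤-trans y≤z z≤x)

  ≤-<-trans : ∀ {x y z} → x ≤ y → y < z → x < z
  ≤-<-trans x≤y y<z = ≰⇒> λ z≤x → <⇒≱ y<z (≤-trans z≤x x≤y)

  0≤x*x : ∀ x → 0# ≤ x * x
  0≤x*x x with total 0# x
  ... | inj₁ 0≤x = *-nonNegative 0≤x 0≤x
  ... | inj₂ x≤0 = ≤-respʳ-≈ (solve 1 (λ x → (:0 :- x) :* (:0 :- x) := x :* x) refl x)
                     (*-nonNegative (0≤y-x x≤0) (0≤y-x x≤0))

  0≤1 : 0# ≤ 1#
  0≤1 = ≤-respʳ-≈ (*-identityˡ 1#) (0≤x*x 1#)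

  0<1 : 0# < 1#
  0<1 = 0≤1 , 0≉1

  +-nonNegative : ∀ {x y} → 0# ≤ x → 0# ≤ y → 0# ≤ x + y
  +-nonNegative 0≤x 0≤y = ≤-respˡ-≈ (+-identityˡ 0#) (+-mono-≤ 0≤x 0≤y)

  0<y-x : ∀ {x y} → x < y → 0# < y - x
  0<y-x {x} {y} (x≤y , x≉y) = 0≤y-x x≤y , λ eq → x≉y (begin-equality
    x            ≈⟨ +-identityˡ x ⟨
    0# + x       ≈⟨ +-congʳ eq ⟩
    (y - x) + x  ≈⟨ solve 2 (λ x y → (y :- x) :+ x := y) refl x y ⟩
    y            ∎)
    where open ≤-Reasoning

  +-monoˡ-< : ∀ z {x y} → x < y → x + z < y + z
  +-monoˡ-< z {x} {y} (x≤y , x≉y) = +-monoˡ-≤ z x≤y , λ eq → x≉y (begin-equality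
    x            ≈⟨ solve 2 (λ x z → x := (x :+ z) :- z) refl x z ⟩
    (x + z) - z  ≈⟨ +-congʳ eq ⟩
    (y + z) - z  ≈⟨ solve 2 (λ x z → (x :+ z) :- z := x) refl y z ⟩
    y            ∎)
    where open ≤-Reasoning

  *-cancel-≈0 : ∀ {x y} → ¬ x ≈ 0# → x * y ≈ 0# → y ≈ 0#
  *-cancel-≈0 {x} {y} x≉0 eq = begin-equality
    y                ≈⟨ *-identityˡ y ⟨
    1# * y           ≈⟨ *-congʳ (⁻¹-inverse x≉0) ⟨
    (x * x ⁻¹) * y   ≈⟨ solve 3 (λ x w y → (x :* w) :* y := w :* (x :* y)) refl x (x ⁻¹) y ⟩
    x ⁻¹ * (x * y)   ≈⟨ *-congˡ eq ⟩
    x ⁻¹ * 0#        ≈⟨ zeroʳ _ ⟩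
    0#               ∎
    where open ≤-Reasoning

  *-positive : ∀ {x y} → 0# < x → 0# < y → 0# < x * y
  *-positive (0≤x , 0≉x) (0≤y , 0≉y) =
    *-nonNegative 0≤x 0≤y , λ eq → 0≉y (sym (*-cancel-≈0 (λ x≈0 → 0≉x (sym x≈0)) (sym eq)))

  *-cancelˡ-≤ : ∀ {z x y} → 0# < z → z * x ≤ z * y → x ≤ y
  *-cancelˡ-≤ {z} {x} {y} 0<z zx≤zy with x ≤? y
  ... | yes x≤y = x≤y
  ... | no x≰y  = contradiction (≤-respʳ-≈ (solve 3 (λ x y z → z :* y :- z :* x := :- (z :* (x :- y))) refl x y z) (0≤y-x zx≤zy))
                    (λ p → <⇒≱ (*-positive 0<z (0<y-x (≰⇒> x≰y))) (0≤-x⇒x≤0 p))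
    where
    0≤-x⇒x≤0 : ∀ {w} → 0# ≤ - w → w ≤ 0#
    0≤-x⇒x≤0 {w} p = 0≤y-x⇒x≤y (≤-respʳ-≈ (solve 1 (λ w → :- w := :0 :- w) refl w) p)

  <⇒≉0 : ∀ {x} → 0# < x → ¬ x ≈ 0#
  <⇒≉0 (_ , 0≉x) x≈0 = 0≉x (sym x≈0)

  ⁻¹-positive : ∀ {x} → 0# < x → 0# < x ⁻¹
  ⁻¹-positive {x} 0<x = ≰⇒> λ x⁻¹≤0 → <⇒≱ 0<1 (begin
    1#         ≈⟨ ⁻¹-inverse (<⇒≉0 0<x) ⟨
    x * x ⁻¹   ≤⟨ *-monoˡ-≤ (<⇒≤ 0<x) x⁻¹≤0 ⟩
    x * 0#     ≈⟨ zeroʳ x ⟩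
    0#         ∎)
    where open ≤-Reasoning

  <-dense : ∀ {x y} → x < y → ∃ λ z → x < z × z < y
  <-dense {x} {y} x<y = (x + d , lower , upper)
    where
    0<2 : 0# < 1# + 1#
    0<2 = <-≤-trans 0<1 (≤-respˡ-≈ (+-identityˡ 1#) (+-monoˡ-≤ 1# 0≤1))
    d = (1# + 1#) ⁻¹ * (y - x)
    0<d : 0# < d
    0<d = *-positive (⁻¹-positive 0<2) (0<y-x x<y)
    d+d≈ : d + d ≈ y - x
    d+d≈ = begin-equality
      d + d                                        ≈⟨ solve 2 (λ h e → h :* e :+ h :* e := ((:1 :+ :1) :* h) :* e) refl ((1# + 1#) ⁻¹) (y - x) ⟩
      ((1# + 1#) * (1# + 1#) ⁻¹) * (y - x)         ≈⟨ *-congʳ (⁻¹-inverse (<⇒≉0 0<2)) ⟩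
      1# * (y - x)                                 ≈⟨ *-identityˡ _ ⟩
      y - x                                        ∎
      where open ≤-Reasoning
    lower : x < x + d
    lower = <-respˡ-≈ (+-identityˡ x) (<-respʳ-≈ (+-comm d x) (+-monoˡ-< x 0<d))
    upper : x + d < y
    upper = <-respˡ-≈ (+-identityˡ _) (<-respʳ-≈ (begin-equality
      d + (x + d)   ≈⟨ solve 2 (λ d x → d :+ (x :+ d) := x :+ (d :+ d)) refl d x ⟩
      x + (d + d)   ≈⟨ +-congˡ d+d≈ ⟩
      x + (y - x)   ≈⟨ solve 2 (λ x y → x :+ (y :- x) := y) refl x y ⟩
      y             ∎) (+-monoˡ-< (x + d) 0<d))
      where open ≤-Reasoning

-- Iterated sums and products over pairs of indices.

module DoubleSum {c ℓ} (M : CommutativeMonoid c ℓ) where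

  open import Data.Nat.Base using (zero; suc)
  open CommutativeMonoid M
  open Algebra.Properties.CommutativeMonoid.Sum M
  open import Relation.Binary.Reasoning.Setoid setoid

  sum-++ : ∀ m {n} (f : Vector Carrier (m ℕ.+ n)) →
           sum f ≈ sum (λ i → f (i ↑ˡ n)) ∙ sum (λ j → f (m ↑ʳ j))
  sum-++ zero    f = sym (identityˡ _)
  sum-++ (suc m) f = trans (∙-congˡ (sum-++ m (f ∘ Fin.suc))) (sym (assoc _ _ _))

  sum-combine : ∀ m n (f : Vector Carrier (m ℕ.* n)) →
                sum f ≈ sum {m} (λ i → sum {n} (λ j → f (combine i j)))
  sum-combine zero    n f = refl
  sum-combine (suc m) n f = trans (sum-++ n f) (∙-congˡ (sum-combine m n (λ k → f (n ↑ʳ k))))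

  -- Over an arbitrary commutative monoid, so that it serves sums and products alike. As `permsAt`
  -- decodes its index by `remQuot`, this separates the image of the pivot from the arrangement of
  -- the rest.
  sum-remQuot : ∀ m n (f : Fin m × Fin n → Carrier) →
                sum (λ k → f (remQuot {m} n k)) ≈ sum {m} (λ i → sum {n} (λ j → f (i , j)))
  sum-remQuot m n f = trans (sum-combine m n _)
    (sum-cong-≋ λ i → sum-cong-≋ λ j → reflexive (≡.cong f (Fin.remQuot-combine i j)))

-- Listings of the permutations that move only the first indices.

module PermutationsFixingFrom where

  open import Data.Nat.Base using (zero; suc)
  open import Data.Fin.Base using () renaming (zero to fzero; suc to fsuc)
  open ≡ using (refl; sym; trans; cong)

  FixesFrom : ∀ {n} → ℕ → Permutation′ n → Set
  FixesFrom s π = ∀ i → s ℕ.≤ toℕ i → π ⟨$⟩ʳ i ≡ i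

  mutual
    -- The bound is irrelevant, so that the permutations do not depend on how it is proved.
    perms : ∀ {m} s → .(s ℕ.≤ m) → Vector (Permutation′ m) (s !)
    perms         zero    _  _ = Perm.id
    perms {suc m} (suc s) s≤m  = permsAt s s≤m fzero

    -- A listing grouped by the image of a chosen pivot `c`: fixing the outer index amounts to
    -- conditioning on where `c` is sent. `perms` takes pivot 0, while the estimate for a stopping
    -- time takes the slot opened at that time.
    permsAt : ∀ {m} s → .(suc s ℕ.≤ suc m) → Fin (suc m) → Vector (Permutation′ (suc m)) (suc s !)
    permsAt s s≤m c k = inserted s s≤m c (remQuot {suc s} (s !) k)

    inserted : ∀ {m} s → .(suc s ℕ.≤ suc m) → Fin (suc m) → Fin (suc s) × Fin (s !) → Permutation′ (suc m)
    inserted s s≤m c (i , j) = Perm.insert c (inject≤ i s≤m) (perms s (ℕ.s≤s⁻¹ s≤m) j)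

  -- The pivot and its image both lie at or below `s`, so the indices above are shifted by one on
  -- either side, and a permutation that fixes them still does so after the insertion.
  punchIn-≤ : ∀ {n} (i : Fin (suc n)) (r : Fin n) → toℕ i ℕ.≤ toℕ r → punchIn i r ≡ fsuc r
  punchIn-≤ fzero    r        _   = refl
  punchIn-≤ (fsuc i) (fsuc r) i≤r = cong fsuc (punchIn-≤ i r (ℕ.s≤s⁻¹ i≤r))

  punchIn-inject≤ : ∀ {m s} .(p : suc s ℕ.≤ suc m) (i : Fin (suc s)) (r : Fin s) →
                    punchIn (inject≤ i p) (inject≤ r (ℕ.s≤s⁻¹ p)) ≡ inject≤ (punchIn i r) p
  punchIn-inject≤         p fzero    r        = refl
  punchIn-inject≤ {zero}  {suc s} p (fsuc i) r = ⊥-elim-irr (ℕ.n≮0 (ℕ.s≤s⁻¹ p))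
  punchIn-inject≤ {suc m} p (fsuc i) fzero    = refl
  punchIn-inject≤ {suc m} p (fsuc i) (fsuc r) = cong fsuc (punchIn-inject≤ (ℕ.s≤s⁻¹ p) i r)

  toℕ-inject≤-≤ : ∀ {m s} .(p : suc s ℕ.≤ m) (i : Fin (suc s)) → toℕ (inject≤ i p) ℕ.≤ s
  toℕ-inject≤-≤ p i = ≡.subst (ℕ._≤ _) (sym (Fin.toℕ-inject≤ i p)) (ℕ.s≤s⁻¹ (Fin.toℕ<n i))

  mutual
    perms-fix : ∀ {m} s .(p : s ℕ.≤ m) j → FixesFrom s (perms s p j)
    perms-fix         zero    p j k _ = refl
    perms-fix {suc m} (suc s) p j     = permsAt-fix s p fzero ℕ.z≤n j

    permsAt-fix : ∀ {m} s .(p : suc s ℕ.≤ suc m) c → toℕ c ℕ.≤ s → ∀ k → FixesFrom (suc s) (permsAt s p c k)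
    permsAt-fix s p c c≤s k (fsuc r) s<r = begin
      Perm.insert c i π ⟨$⟩ʳ fsuc r        ≡⟨ cong (Perm.insert c i π ⟨$⟩ʳ_) (punchIn-≤ c r (ℕ.≤-trans c≤s s≤r)) ⟨
      Perm.insert c i π ⟨$⟩ʳ punchIn c r   ≡⟨ Perm.insert-punchIn c i π r ⟩
      punchIn i (π ⟨$⟩ʳ r)                 ≡⟨ cong (punchIn i) (perms-fix s (ℕ.s≤s⁻¹ p) j r s≤r) ⟩
      punchIn i r                          ≡⟨ punchIn-≤ i r (ℕ.≤-trans (toℕ-inject≤-≤ p (proj₁ (remQuot {suc s} (s !) k))) s≤r) ⟩
      fsuc r                               ∎
      where
      open ≡.≡-Reasoning
      s≤r = ℕ.s≤s⁻¹ s<r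
      i = inject≤ (proj₁ (remQuot {suc s} (s !) k)) p
      j = proj₂ (remQuot {suc s} (s !) k)
      π = perms s (ℕ.s≤s⁻¹ p) j

  insert-self : ∀ {m n} i j (π : Perm.Permutation m n) → Perm.insert i j π ⟨$⟩ʳ i ≡ j
  insert-self i j π with i Fin.≟ i
  ... | yes _  = refl
  ... | no i≢i = contradiction refl i≢i

  insert-cong : ∀ {m n} i {j j′} {π π′ : Perm.Permutation m n} → j ≡ j′ → π Perm.≈ π′ →
                Perm.insert i j π Perm.≈ Perm.insert i j′ π′
  insert-cong i {j} refl π≈π′ k with i Fin.≟ k
  ... | yes _ = refl
  ... | no _  = cong (punchIn j) (π≈π′ _)

  mutual
    perms-complete : ∀ {m} s .(p : s ℕ.≤ m) π → FixesFrom s π → ∃ λ j → π Perm.≈ perms s p j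
    perms-complete         zero    p π fixes = fzero , λ i → fixes i ℕ.z≤n
    perms-complete {suc m} (suc s) p π fixes = permsAt-complete s p fzero ℕ.z≤n π fixes

    permsAt-complete : ∀ {m} s .(p : suc s ℕ.≤ suc m) (c : Fin (suc m)) → toℕ c ℕ.≤ s → ∀ π → FixesFrom (suc s) π →
                       ∃ λ k → π Perm.≈ permsAt s p c k
    permsAt-complete {m} s p c c≤s π fixes =
      combine i j , λ x → trans (sym (Perm.insert-remove c π x))
        (trans (insert-cong c (sym inject-i) π′≈ x)
               (cong (λ ij → inserted s p c ij ⟨$⟩ʳ x) (sym (Fin.remQuot-combine i j))))
      where
      open ≡.≡-Reasoning
      -- If the image of `c` lay in the fixed tail, it would be its own image, and injectivity would
      -- put `c` itself into the tail.
      πc≤s : toℕ (π ⟨$⟩ʳ c) ℕ.< suc s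
      πc≤s with toℕ (π ⟨$⟩ʳ c) ℕ.<? suc s
      ... | yes lt = lt
      ... | no ge  = ≡.subst (λ x → toℕ x ℕ.< suc s) c≡πc (ℕ.s≤s c≤s)
        where
        c≡πc : c ≡ π ⟨$⟩ʳ c
        c≡πc = begin
          c                                  ≡⟨ Perm.inverseˡ π ⟨
          π Perm.⟨$⟩ˡ (π ⟨$⟩ʳ c)               ≡⟨ cong (π Perm.⟨$⟩ˡ_) (fixes _ (ℕ.≮⇒≥ ge)) ⟨
          π Perm.⟨$⟩ˡ (π ⟨$⟩ʳ (π ⟨$⟩ʳ c))        ≡⟨ Perm.inverseˡ π ⟩
          π ⟨$⟩ʳ c                           ∎
      i : Fin (suc s)
      i = Fin.fromℕ< πc≤s
      inject-i : inject≤ i p ≡ π ⟨$⟩ʳ c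
      inject-i = Fin.toℕ-injective (trans (Fin.toℕ-inject≤ i p) (Fin.toℕ-fromℕ< πc≤s))
      π′ = Perm.remove c π
      π′-fixes : FixesFrom s π′
      π′-fixes r s≤r = Fin.punchIn-injective (π ⟨$⟩ʳ c) _ _ (begin
        punchIn (π ⟨$⟩ʳ c) (π′ ⟨$⟩ʳ r)   ≡⟨ Perm.punchIn-permute π c r ⟨
        π ⟨$⟩ʳ punchIn c r             ≡⟨ cong (π ⟨$⟩ʳ_) (punchIn-≤ c r (ℕ.≤-trans c≤s s≤r)) ⟩
        π ⟨$⟩ʳ fsuc r                  ≡⟨ fixes (fsuc r) (ℕ.s≤s s≤r) ⟩
        fsuc r                         ≡⟨ punchIn-≤ (π ⟨$⟩ʳ c) r (ℕ.≤-trans (ℕ.s≤s⁻¹ πc≤s) s≤r) ⟨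
        punchIn (π ⟨$⟩ʳ c) r             ∎)
      rec = perms-complete s (ℕ.s≤s⁻¹ p) π′ π′-fixes
      j = proj₁ rec
      π′≈ = proj₂ rec

  mutual
    perms-distinct : ∀ {m} s .(p : s ℕ.≤ m) j j′ → perms s p j Perm.≈ perms s p j′ → j ≡ j′
    perms-distinct         zero    p fzero fzero _ = refl
    perms-distinct {suc m} (suc s) p = permsAt-distinct s p fzero

    -- The value at `c` reveals the outer index; the other values, with `punchIn` undone, reveal the
    -- inner one.
    permsAt-distinct : ∀ {m} s .(p : suc s ℕ.≤ suc m) c k k′ → permsAt s p c k Perm.≈ permsAt s p c k′ → k ≡ k′
    permsAt-distinct s p c k k′ eq = begin
      k              ≡⟨ Fin.combine-remQuot {suc s} (s !) k ⟨
      combine i j    ≡⟨ ≡.cong₂ combine i≡i′ j≡j′ ⟩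
      combine i′ j′  ≡⟨ Fin.combine-remQuot {suc s} (s !) k′ ⟩
      k′             ∎
      where
      open ≡.≡-Reasoning
      i  = proj₁ (remQuot {suc s} (s !) k)
      j  = proj₂ (remQuot {suc s} (s !) k)
      i′ = proj₁ (remQuot {suc s} (s !) k′)
      j′ = proj₂ (remQuot {suc s} (s !) k′)
      π  = perms s (ℕ.s≤s⁻¹ p) j
      π′ = perms s (ℕ.s≤s⁻¹ p) j′
      images : inject≤ i p ≡ inject≤ i′ p
      images = trans (sym (insert-self c (inject≤ i p) π)) (trans (eq c) (insert-self c (inject≤ i′ p) π′))
      i≡i′ = Fin.inject≤-injective p p i i′ images
      j≡j′ = perms-distinct s (ℕ.s≤s⁻¹ p) j j′ λ r → Fin.punchIn-injective (inject≤ i p) _ _ (begin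
        punchIn (inject≤ i p) (π ⟨$⟩ʳ r)                        ≡⟨ Perm.insert-punchIn c (inject≤ i p) π r ⟨
        Perm.insert c (inject≤ i p) π ⟨$⟩ʳ punchIn c r          ≡⟨ eq (punchIn c r) ⟩
        Perm.insert c (inject≤ i′ p) π′ ⟨$⟩ʳ punchIn c r        ≡⟨ Perm.insert-punchIn c (inject≤ i′ p) π′ r ⟩
        punchIn (inject≤ i′ p) (π′ ⟨$⟩ʳ r)                      ≡⟨ cong (λ x → punchIn x (π′ ⟨$⟩ʳ r)) images ⟨
        punchIn (inject≤ i p) (π′ ⟨$⟩ʳ r)                       ∎)

-- The Boolean equation accompanies the inequality so that a `rewrite` can resolve the `if` in
-- `replaceFirst` and similar families.
<?-view : ∀ k s → (k ℕ.< s × does (k ℕ.<? s) ≡ true) ⊎ (s ℕ.≤ k × does (k ℕ.<? s) ≡ false)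
<?-view k s with k ℕ.<? s
... | yes k<s = inj₁ (k<s , dec-true (k ℕ.<? s) k<s)
... | no k≮s  = inj₂ (ℕ.≮⇒≥ k≮s , dec-false (k ℕ.<? s) k≮s)

-- Finite sums, products and powers; the inequality of arithmetic and geometric means.

module SumsAndProducts (R : RealField) where

  open OrderedField R
  open Solver using (solve; _:=_; _:+_; _:*_; _:-_; :0; :1)
  open import Data.Nat.Base using (zero; suc)
  open ≤-Reasoning

  module Sum₂ = DoubleSum +-commutativeMonoid
  module Prod₂ = DoubleSum *-commutativeMonoid

  ∑-mono-≤ : ∀ {n} {a b : Vector ℝ n} → (∀ i → a i ≤ b i) → ∑ a ≤ ∑ b
  ∑-mono-≤ {zero}  a≤b = ≤-refl
  ∑-mono-≤ {suc n} a≤b = +-mono-≤ (a≤b Fin.zero) (∑-mono-≤ (a≤b ∘ Fin.suc))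

  ∑-nonNegative : ∀ {n} {a : Vector ℝ n} → (∀ i → 0# ≤ a i) → 0# ≤ ∑ a
  ∑-nonNegative {zero}  0≤a = ≤-refl
  ∑-nonNegative {suc n} 0≤a = +-nonNegative (0≤a Fin.zero) (∑-nonNegative (0≤a ∘ Fin.suc))

  ∏-nonNegative : ∀ {n} {a : Vector ℝ n} → (∀ i → 0# ≤ a i) → 0# ≤ ∏ a
  ∏-nonNegative {zero}  0≤a = 0≤1
  ∏-nonNegative {suc n} 0≤a = *-nonNegative (0≤a Fin.zero) (∏-nonNegative (0≤a ∘ Fin.suc))

  ∏-mono-≤ : ∀ {n} {a b : Vector ℝ n} → (∀ i → 0# ≤ a i) → (∀ i → a i ≤ b i) → ∏ a ≤ ∏ b
  ∏-mono-≤ {zero}  0≤a a≤b = ≤-refl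
  ∏-mono-≤ {suc n} 0≤a a≤b =
    *-mono-≤ (0≤a Fin.zero) (∏-nonNegative λ i → ≤-trans (0≤a (Fin.suc i)) (a≤b (Fin.suc i)))
      (a≤b Fin.zero) (∏-mono-≤ (0≤a ∘ Fin.suc) (a≤b ∘ Fin.suc))

  ∑-const : ∀ n x → ∑ {n} (const x) ≈ fromℕ n * x
  ∑-const n x = begin-equality
    ∑ {n} (const x)      ≈⟨ Sum.sum-cong-≋ {n} (λ _ → sym (*-identityˡ x)) ⟩
    ∑ {n} (const (1# * x)) ≈⟨ Sum.*-distribʳ-sum x (replicate n 1#) ⟨
    ∑ {n} (const 1#) * x ≈⟨ *-congʳ (Sum.sum-replicate n) ⟩
    fromℕ n * x          ∎

  ∏-const : ∀ n x → ∏ {n} (const x) ≈ x ^ n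
  ∏-const n x = Prod.sum-replicate n

  ∏-^ : ∀ {m} n (a : Vector ℝ m) → ∏ (λ i → a i ^ n) ≈ ∏ a ^ n
  ∏-^ {m} n a = begin-equality
    ∏ (λ i → a i ^ n)                     ≈⟨ Prod.sum-cong-≋ {m} (λ i → ∏-const n (a i)) ⟨
    ∏ (λ i → ∏ {n} (const (a i)))         ≈⟨ Prod.∑-comm {m} {n} (λ i _ → a i) ⟩
    ∏ {n} (λ _ → ∏ a)                     ≈⟨ ∏-const n (∏ a) ⟩
    ∏ a ^ n                               ∎

  ^-nonNegative : ∀ {x} n → 0# ≤ x → 0# ≤ x ^ n
  ^-nonNegative zero    0≤x = 0≤1
  ^-nonNegative (suc n) 0≤x = *-nonNegative 0≤x (^-nonNegative n 0≤x)

  ^-mono-≤ : ∀ {x y} n → 0# ≤ x → x ≤ y → x ^ n ≤ y ^ n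
  ^-mono-≤ zero    0≤x x≤y = ≤-refl
  ^-mono-≤ (suc n) 0≤x x≤y = *-mono-≤ 0≤x (^-nonNegative n (≤-trans 0≤x x≤y)) x≤y (^-mono-≤ n 0≤x x≤y)

  ^-positive : ∀ {x} n → 0# < x → 0# < x ^ n
  ^-positive zero    0<x = 0<1
  ^-positive (suc n) 0<x = *-positive 0<x (^-positive n 0<x)

  -- If `y < x`, then `x` is positive, and `x ^ n` may be cancelled from `x ^ suc n ≤ y * x ^ n`.
  ^-cancel-≤ : ∀ {x y} n → 0# ≤ y → x ^ suc n ≤ y ^ suc n → x ≤ y
  ^-cancel-≤ {x} {y} n 0≤y xⁿ≤yⁿ with x ≤? y
  ... | yes x≤y = x≤y
  ... | no x≰y  = *-cancelˡ-≤ (^-positive n 0<x) (begin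
    x ^ n * x      ≈⟨ *-comm _ _ ⟩
    x ^ suc n      ≤⟨ xⁿ≤yⁿ ⟩
    y * y ^ n      ≤⟨ *-monoˡ-≤ 0≤y (^-mono-≤ n 0≤y (<⇒≤ y<x)) ⟩
    y * x ^ n      ≈⟨ *-comm _ _ ⟩
    x ^ n * y      ∎)
    where
    y<x = ≰⇒> x≰y
    0<x = ≤-<-trans 0≤y y<x

  fromℕ-nonNegative : ∀ n → 0# ≤ fromℕ n
  fromℕ-nonNegative zero    = ≤-refl
  fromℕ-nonNegative (suc n) = +-nonNegative 0≤1 (fromℕ-nonNegative n)

  fromℕ-positive : ∀ n → 0# < fromℕ (suc n)
  fromℕ-positive n = <-≤-trans 0<1 (≤-respˡ-≈ (+-identityʳ 1#) (+-monoʳ-≤ 1# (fromℕ-nonNegative n)))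

  -- Convexity: the power lies above its tangent at `x`. The gap for the next exponent is `z` times
  -- the present gap plus `(n + 1) x^n (z - x)²`.
  tangent : ∀ n {x z} → 0# ≤ x → 0# ≤ z →
            fromℕ (suc n) * z * x ^ n ≤ z ^ suc n + fromℕ n * x ^ suc n
  tangent zero {x} {z} 0≤x 0≤z = ≤-reflexive
    (solve 2 (λ x z → (:1 :+ :0) :* z :* :1 := z :* :1 :+ :0 :* (x :* :1)) refl x z)
  tangent (suc n) {x} {z} 0≤x 0≤z = 0≤y-x⇒x≤y (≤-respʳ-≈
    (solve 5 (λ x z m X Z →
        z :* ((z :* Z :+ m :* (x :* X)) :- (:1 :+ m) :* z :* X) :+ (:1 :+ m) :* X :* ((z :- x) :* (z :- x))
        := (z :* (z :* Z) :+ (:1 :+ m) :* (x :* (x :* X))) :- (:1 :+ (:1 :+ m)) :* z :* (x :* X))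
      refl x z (fromℕ n) (x ^ n) (z ^ n))
    (+-nonNegative (*-nonNegative 0≤z (0≤y-x (tangent n 0≤x 0≤z)))
      (*-nonNegative (*-nonNegative (fromℕ-nonNegative (suc n)) (^-nonNegative n 0≤x)) (0≤x*x (z - x)))))

  -- Induction with `ν`, the mean of all numbers but the first: `a₀ + N ν` equals `(N + 1) μ`, so
  -- that `a₀ ν^N` becomes an expression in `μ` and `ν` to which the tangent at `ν` applies.
  am-gm : ∀ n (a : Vector ℝ n) μ → (∀ i → 0# ≤ a i) → 0# ≤ μ → fromℕ n * μ ≈ ∑ a → ∏ a ≤ μ ^ n
  am-gm zero a μ 0≤a 0≤μ eq = ≤-refl
  am-gm (suc zero) a μ 0≤a 0≤μ eq = ≤-reflexive (*-congʳ (begin-equality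
    a Fin.zero        ≈⟨ +-identityʳ _ ⟨
    a Fin.zero + 0#   ≈⟨ eq ⟨
    (1# + 0#) * μ     ≈⟨ *-congʳ (+-identityʳ 1#) ⟩
    1# * μ            ≈⟨ *-identityˡ μ ⟩
    μ                 ∎))
  am-gm (suc (suc n)) a μ 0≤a 0≤μ eq = begin
    a₀ * ∏ (a ∘ Fin.suc)                          ≤⟨ *-monoˡ-≤ (0≤a Fin.zero) (am-gm (suc n) (a ∘ Fin.suc) ν (0≤a ∘ Fin.suc) 0≤ν Nν≈) ⟩
    a₀ * ν ^ N                                    ≈⟨ solve 4 (λ a m v V → a :* V := (a :+ m :* v) :* V :- m :* (v :* V)) refl a₀ (fromℕ N) ν (ν ^ N) ⟩
    (a₀ + fromℕ N * ν) * ν ^ N - fromℕ N * ν ^ suc N ≈⟨ +-congʳ (*-congʳ (trans (+-congˡ Nν≈) (sym eq))) ⟩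
    fromℕ (suc N) * μ * ν ^ N - fromℕ N * ν ^ suc N  ≤⟨ +-monoˡ-≤ _ (tangent N 0≤ν 0≤μ) ⟩
    (μ ^ suc N + fromℕ N * ν ^ suc N) - fromℕ N * ν ^ suc N ≈⟨ solve 2 (λ x y → (x :+ y) :- y := x) refl (μ ^ suc N) (fromℕ N * ν ^ suc N) ⟩
    μ ^ suc N                                     ∎
    where
    N  = suc n
    a₀ = a Fin.zero
    S  = ∑ (a ∘ Fin.suc)
    ν  = fromℕ N ⁻¹ * S
    0≤ν : 0# ≤ ν
    0≤ν = *-nonNegative (<⇒≤ (⁻¹-positive (fromℕ-positive n))) (∑-nonNegative (0≤a ∘ Fin.suc))
    Nν≈ : fromℕ N * ν ≈ S
    Nν≈ = begin-equality
      fromℕ N * (fromℕ N ⁻¹ * S)   ≈⟨ *-assoc _ _ _ ⟨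
      (fromℕ N * fromℕ N ⁻¹) * S   ≈⟨ *-congʳ (⁻¹-inverse (<⇒≉0 (fromℕ-positive n))) ⟩
      1# * S                       ≈⟨ *-identityˡ S ⟩
      S                            ∎

  -- The form in which the inequality is applied. The lower bound on the geometric mean is stated by
  -- a power, so that no root of the product has to be taken.
  am-gm-≤ : ∀ n (a : Vector ℝ n) y → (∀ i → 0# ≤ a i) → y ^ n ≤ ∏ a → fromℕ n * y ≤ ∑ a
  am-gm-≤ zero    a y 0≤a yⁿ≤ = ≤-reflexive (zeroˡ y)
  am-gm-≤ (suc n) a y 0≤a yⁿ≤ = ≤-respʳ-≈ Nμ≈
    (*-monoˡ-≤ (fromℕ-nonNegative (suc n)) (^-cancel-≤ n 0≤μ (≤-trans yⁿ≤ (am-gm (suc n) a μ 0≤a 0≤μ Nμ≈))))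
    where
    μ = fromℕ (suc n) ⁻¹ * ∑ a
    0≤μ : 0# ≤ μ
    0≤μ = *-nonNegative (<⇒≤ (⁻¹-positive (fromℕ-positive n))) (∑-nonNegative 0≤a)
    Nμ≈ : fromℕ (suc n) * μ ≈ ∑ a
    Nμ≈ = begin-equality
      fromℕ (suc n) * (fromℕ (suc n) ⁻¹ * ∑ a)   ≈⟨ *-assoc _ _ _ ⟨
      (fromℕ (suc n) * fromℕ (suc n) ⁻¹) * ∑ a   ≈⟨ *-congʳ (⁻¹-inverse (<⇒≉0 (fromℕ-positive n))) ⟩
      1# * ∑ a                                   ≈⟨ *-identityˡ _ ⟩
      ∑ a                                        ∎

  -- Padding with ones keeps the second factor indexed by all of `Fin n`, without an embedding of
  -- the remaining indices.
  ∏-first : ∀ {n} s (s≤n : s ℕ.≤ n) (h : Vector ℝ n) →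
            ∏ h ≈ ∏ {s} (λ i → h (inject≤ i s≤n)) * ∏ (λ i → if does (toℕ i ℕ.<? s) then 1# else h i)
  ∏-first zero s≤n h = sym (*-identityˡ _)
  ∏-first {suc n} (suc s) s≤n h = begin-equality
    h₀ * ∏ (h ∘ Fin.suc)           ≈⟨ *-congˡ (∏-first s (ℕ.s≤s⁻¹ s≤n) (h ∘ Fin.suc)) ⟩
    h₀ * (P * Q)                   ≈⟨ solve 3 (λ a p q → a :* (p :* q) := (a :* p) :* (:1 :* q)) refl h₀ P Q ⟩
    (h₀ * P) * (1# * Q)            ∎
    where
    h₀ = h Fin.zero
    P = ∏ {s} (λ i → h (Fin.suc (inject≤ i (ℕ.s≤s⁻¹ s≤n))))
    Q = ∏ (λ i → if does (toℕ i ℕ.<? s) then 1# else h (Fin.suc i))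

  ∏-if : ∀ {n} s → s ℕ.≤ n → ∀ x → ∏ {n} (λ i → if does (toℕ i ℕ.<? s) then x else 1#) ≈ x ^ s
  ∏-if {n}     zero    s≤n x = trans (Prod.sum-replicate-zero n) refl
  ∏-if {suc n} (suc s) s≤n x = *-congˡ (∏-if {n} s (ℕ.s≤s⁻¹ s≤n) x)

  -- Each factor is skipped by exactly one of the `suc s` inner products, and so occurs `s` times
  -- altogether.
  ∏-punchIn : ∀ s (g : Vector ℝ (suc s)) → ∏ {suc s} (λ i → ∏ {s} (λ r → g (punchIn i r))) ≈ ∏ g ^ s
  ∏-punchIn zero    g = *-identityˡ 1#
  ∏-punchIn (suc s) g = begin-equality
    P * ∏ {suc s} (λ i → g₀ * ∏ {s} (λ r → g (Fin.suc (punchIn i r))))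
      ≈⟨ *-congˡ (Prod.∑-distrib-+ {suc s} (const g₀) (λ i → ∏ {s} (λ r → g (Fin.suc (punchIn i r))))) ⟩
    P * (∏ {suc s} (const g₀) * ∏ {suc s} (λ i → ∏ {s} (λ r → g (Fin.suc (punchIn i r)))))
      ≈⟨ *-congˡ (*-cong (∏-const (suc s) g₀) (∏-punchIn s (g ∘ Fin.suc))) ⟩
    P * (g₀ ^ suc s * P ^ s)
      ≈⟨ solve 3 (λ p a q → p :* (a :* q) := a :* (p :* q)) refl P (g₀ ^ suc s) (P ^ s) ⟩
    g₀ ^ suc s * P ^ suc s
      ≈⟨ Exp.^-distrib-* g₀ P (suc s) ⟨
    (g₀ * P) ^ suc s ∎
    where
    g₀ = g Fin.zero
    P  = ∏ (g ∘ Fin.suc)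

-- A lower bound for permanents over the shuffled indices.

module PermanentBound (R : RealField) where

  open OrderedField R
  open SumsAndProducts R
  open PermutationsFixingFrom
  open Solver using (solve; _:=_; _:+_; _:*_; :0; :1)
  open import Data.Nat.Base using (zero; suc)
  open ≤-Reasoning

  -- Among the permutations, `k` is sent to each of the first `suc s` indices equally often, namely
  -- `s !` times. For `k = 0` the image is the outer index; otherwise the count follows from the
  -- smaller permutations by `∏-punchIn`.
  ∏-perms : ∀ {m} s (p : suc s ℕ.≤ m) (h : Vector ℝ m) k → toℕ k ℕ.≤ s →
            ∏ {suc s !} (λ j → h (perms (suc s) p j ⟨$⟩ʳ k)) ≈ ∏ {suc s} (λ i → h (inject≤ i p)) ^ (s !)
  ∏-perms {suc m} s p h Fin.zero k≤s = begin-equality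
    ∏ {suc s !} (λ j → h (permsAt s p Fin.zero j ⟨$⟩ʳ Fin.zero))
      ≈⟨ Prod₂.sum-remQuot (suc s) (s !) (λ ij → h (inserted s p Fin.zero ij ⟨$⟩ʳ Fin.zero)) ⟩
    ∏ {suc s} (λ i → ∏ {s !} (λ j → h (inject≤ i p)))
      ≈⟨ Prod.sum-cong-≋ {suc s} (λ i → ∏-const (s !) (h (inject≤ i p))) ⟩
    ∏ {suc s} (λ i → h (inject≤ i p) ^ (s !))
      ≈⟨ ∏-^ {suc s} (s !) (λ i → h (inject≤ i p)) ⟩
    ∏ {suc s} (λ i → h (inject≤ i p)) ^ (s !) ∎
  ∏-perms {suc m} (suc s) p h (Fin.suc k) k≤s = begin-equality
    ∏ {suc (suc s) !} (λ j → h (permsAt (suc s) p Fin.zero j ⟨$⟩ʳ Fin.suc k))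
      ≈⟨ Prod₂.sum-remQuot (suc (suc s)) (suc s !) (λ ij → h (inserted (suc s) p Fin.zero ij ⟨$⟩ʳ Fin.suc k)) ⟩
    ∏ {suc (suc s)} (λ i → ∏ {suc s !} (λ j → h (inserted (suc s) p Fin.zero (i , j) ⟨$⟩ʳ Fin.suc k)))
      ≈⟨ Prod.sum-cong-≋ {suc (suc s)} (λ i → Prod.sum-cong-≋ {suc s !} (λ j →
           reflexive (≡.cong h (Perm.insert-punchIn Fin.zero (inject≤ i p) (perms (suc s) p′ j) k)))) ⟩
    ∏ {suc (suc s)} (λ i → ∏ {suc s !} (λ j → h (punchIn (inject≤ i p) (perms (suc s) p′ j ⟨$⟩ʳ k))))
      ≈⟨ Prod.sum-cong-≋ {suc (suc s)} (λ i → ∏-perms s p′ (λ r → h (punchIn (inject≤ i p) r)) k (ℕ.s≤s⁻¹ k≤s)) ⟩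
    ∏ {suc (suc s)} (λ i → ∏ {suc s} (λ r → h (punchIn (inject≤ i p) (inject≤ r p′))) ^ (s !))
      ≈⟨ ∏-^ {suc (suc s)} (s !) (λ i → ∏ {suc s} (λ r → h (punchIn (inject≤ i p) (inject≤ r p′)))) ⟩
    ∏ {suc (suc s)} (λ i → ∏ {suc s} (λ r → h (punchIn (inject≤ i p) (inject≤ r p′)))) ^ (s !)
      ≈⟨ Exp.^-congˡ (s !) (Prod.sum-cong-≋ {suc (suc s)} (λ i → Prod.sum-cong-≋ {suc s} (λ r →
           reflexive (≡.cong h (punchIn-inject≤ p i r))))) ⟩
    ∏ {suc (suc s)} (λ i → ∏ {suc s} (λ r → h (inject≤ (punchIn i r) p))) ^ (s !)
      ≈⟨ Exp.^-congˡ (s !) (∏-punchIn (suc s) (λ i → h (inject≤ i p))) ⟩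
    (∏ {suc (suc s)} (λ i → h (inject≤ i p)) ^ suc s) ^ (s !)
      ≈⟨ Exp.^-assocʳ (∏ {suc (suc s)} (λ i → h (inject≤ i p))) (suc s) (s !) ⟩
    ∏ {suc (suc s)} (λ i → h (inject≤ i p)) ^ (suc s !) ∎
    where
    p′ : suc s ℕ.≤ m
    p′ = ℕ.s≤s⁻¹ p

  -- AM-GM over all the permutations at once, each f k r with r < s occurring (s - 1)! times.
  permanent-bound : ∀ {m} s (p : s ℕ.≤ m) (f : Fin m → Fin m → ℝ) (g : Vector ℝ m) c →
    (∀ k r → 0# ≤ f k r) → (∀ k → 0# ≤ g k) → 0# ≤ c → c ≤ 1# →
    (∀ k → toℕ k ℕ.< s → c * g k ^ s ≤ ∏ {s} (λ r → f k (inject≤ r p))) →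
    (∀ k → s ℕ.≤ toℕ k → g k ≤ f k k) →
    fromℕ (s !) * (c * ∏ g) ≤ ∑ {s !} (λ j → ∏ (λ k → f k (perms s p j ⟨$⟩ʳ k)))
  permanent-bound zero p f g c 0≤f 0≤g 0≤c c≤1 first rest = begin
    (1# + 0#) * (c * ∏ g)    ≈⟨ solve 2 (λ c g → (:1 :+ :0) :* (c :* g) := c :* g) refl c (∏ g) ⟩
    c * ∏ g                  ≤⟨ *-mono-≤ 0≤c (∏-nonNegative λ k → 0≤f k k) c≤1 (∏-mono-≤ 0≤g λ k → rest k ℕ.z≤n) ⟩
    1# * ∏ (λ k → f k k)     ≈⟨ *-identityˡ _ ⟩
    ∏ (λ k → f k k)          ≈⟨ +-identityʳ _ ⟨
    ∏ (λ k → f k k) + 0#     ∎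
  permanent-bound {m} (suc s) p f g c 0≤f 0≤g 0≤c c≤1 first rest =
    am-gm-≤ N (λ j → ∏ (λ k → f k (perms (suc s) p j ⟨$⟩ʳ k))) (c * ∏ g) (λ j → ∏-nonNegative λ k → 0≤f k _) (begin
      (c * ∏ g) ^ N                                          ≈⟨ Exp.^-distrib-* c (∏ g) N ⟩
      c ^ N * ∏ g ^ N                                        ≈⟨ *-cong cᴺ (∏-^ N g) ⟨
      ∏ d * ∏ (λ k → g k ^ N)                                ≈⟨ Prod.∑-distrib-+ d (λ k → g k ^ N) ⟨
      ∏ (λ k → d k * g k ^ N)                                ≤⟨ ∏-mono-≤ (λ k → *-nonNegative (0≤d k) (^-nonNegative N (0≤g k))) column ⟩
      ∏ (λ k → ∏ {N} (λ j → f k (perms (suc s) p j ⟨$⟩ʳ k))) ≈⟨ Prod.∑-comm {N} {m} (λ j k → f k (perms (suc s) p j ⟨$⟩ʳ k)) ⟨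
      ∏ {N} (λ j → ∏ (λ k → f k (perms (suc s) p j ⟨$⟩ʳ k))) ∎)
    where
    N = suc s !
    -- The factor `c ^ N` is shared equally by the `suc s` shuffled columns; as `N = suc s * s !`,
    -- each of them gets `c ^ (s !)`. That matches the hypothesis `first`, which allows one factor
    -- `c` per `suc s` powers of `g k`.
    d : Vector ℝ m
    d k = if does (toℕ k ℕ.<? suc s) then c ^ (s !) else 1#
    0≤d : ∀ k → 0# ≤ d k
    0≤d k with <?-view (toℕ k) (suc s)
    ... | inj₁ (_ , eq) rewrite eq = ^-nonNegative (s !) 0≤c
    ... | inj₂ (_ , eq) rewrite eq = 0≤1
    cᴺ : ∏ d ≈ c ^ N
    cᴺ = begin-equality
      ∏ d                    ≈⟨ ∏-if (suc s) p (c ^ (s !)) ⟩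
      (c ^ (s !)) ^ suc s    ≈⟨ Exp.^-assocʳ c (s !) (suc s) ⟩
      c ^ (s ! ℕ.* suc s)    ≈⟨ Exp.^-congʳ c (ℕ.*-comm (s !) (suc s)) ⟩
      c ^ N                  ∎
    column : ∀ k → d k * g k ^ N ≤ ∏ {N} (λ j → f k (perms (suc s) p j ⟨$⟩ʳ k))
    column k with <?-view (toℕ k) (suc s)
    ... | inj₁ (k<s , eq) rewrite eq = begin
      c ^ (s !) * g k ^ N                             ≈⟨ *-congˡ (Exp.^-assocʳ (g k) (suc s) (s !)) ⟨
      c ^ (s !) * (g k ^ suc s) ^ (s !)               ≈⟨ Exp.^-distrib-* c (g k ^ suc s) (s !) ⟨
      (c * g k ^ suc s) ^ (s !)                       ≤⟨ ^-mono-≤ (s !) (*-nonNegative 0≤c (^-nonNegative (suc s) (0≤g k))) (first k k<s) ⟩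
      ∏ {suc s} (λ r → f k (inject≤ r p)) ^ (s !)     ≈⟨ ∏-perms s p (f k) k (ℕ.s≤s⁻¹ k<s) ⟨
      ∏ {N} (λ j → f k (perms (suc s) p j ⟨$⟩ʳ k))    ∎
    ... | inj₂ (s≤k , eq) rewrite eq = begin
      1# * g k ^ N                                    ≈⟨ *-identityˡ _ ⟩
      g k ^ N                                         ≤⟨ ^-mono-≤ N (0≤g k) (rest k s≤k) ⟩
      f k k ^ N                                       ≈⟨ ∏-const N (f k k) ⟨
      ∏ {N} (const (f k k))                           ≈⟨ Prod.sum-cong-≋ {N} (λ j → reflexive (≡.cong (f k) (perms-fix (suc s) p j k s≤k))) ⟨
      ∏ {N} (λ j → f k (perms (suc s) p j ⟨$⟩ʳ k))    ∎

-- Conditions on single values and their probabilities.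

module Regions (R : RealField) where

  open OrderedField R
  open SumsAndProducts R

  -- The three conditions that stopping at a given time puts on a value: rejected before that time,
  -- accepted at it, not looked at after it.
  data Region : Set where
    atMost above : ℝ → Region
    everything   : Region

  mass : Region → (ℝ → ℝ) → ℝ
  mass (atMost a)  F = F a
  mass (above a)   F = 1# - F a
  mass everything  F = 1#

  -- The bound must be nonnegative because smallness of a distribution controls it only from zero
  -- on.
  data Passive : Region → Set where
    atMost     : ∀ {a} → 0# ≤ a → Passive (atMost a)
    everything : Passive everything

  -- Weaker than `IsCDF`, so that it can be derived for `G` from the root equation alone.
  Proper : (ℝ → ℝ) → Set
  Proper F = ∀ x → (0# ≤ F x) × (F x ≤ 1#)

  mass-nonNegative : ∀ V {F} → Proper F → 0# ≤ mass V F
  mass-nonNegative (atMost a)  proper = proj₁ (proper a)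
  mass-nonNegative (above a)   proper = 0≤y-x (proj₂ (proper a))
  mass-nonNegative everything  proper = 0≤1

-- The comparison for a single stopping time.

module SlotBound (R : RealField) where

  open OrderedField R
  open SumsAndProducts R
  open PermanentBound R
  open Regions R
  open PermutationsFixingFrom
  open Solver using (solve; _:=_; _:+_; _:*_; _:-_; :1)
  open import Data.Nat.Base using (zero; suc)
  open ≤-Reasoning

  ∏-one : ∀ n → ∏ {n} (const 1#) ≈ 1#
  ∏-one n = Prod.sum-replicate-zero n

  1^n≈1 : ∀ n → 1# ^ n ≈ 1#
  1^n≈1 n = trans (sym (∏-const n 1#)) (∏-one n)

  -- AM-GM for the numbers g (q + 1 - F i), using F (q + 1 - F) = q + (1 - F) (F - q) ≥ q.
  root-deficit : ∀ n (F : Vector ℝ n) g q → 0# ≤ q → 0# ≤ g → g ≤ 1# → (∀ i → q ≤ F i) → (∀ i → F i ≤ 1#) →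
                 g ^ n ≈ ∏ F → fromℕ n * (q * (1# - g)) ≤ ∑ (λ i → 1# - F i)
  root-deficit n F g q 0≤q 0≤g g≤1 q≤F F≤1 gⁿ≈∏F = begin
    N * (q * (1# - g))          ≈⟨ solve 3 (λ N q g → N :* (q :* (:1 :- g)) := N :* q :- g :* (N :* q)) refl N q g ⟩
    N * q - g * (N * q)         ≤⟨ +-monoˡ-≤ _ Nq≤ ⟩
    g * (N * q + D) - g * (N * q) ≈⟨ solve 3 (λ g x D → g :* (x :+ D) :- g :* x := g :* D) refl g (N * q) D ⟩
    g * D                       ≤⟨ *-monoʳ-≤ 0≤D g≤1 ⟩
    1# * D                      ≈⟨ *-identityˡ D ⟩
    D                           ∎
    where
    N = fromℕ n
    D = ∑ (λ i → 1# - F i)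
    b : Vector ℝ n
    b i = q + (1# - F i)
    0≤1-F : ∀ i → 0# ≤ 1# - F i
    0≤1-F i = 0≤y-x (F≤1 i)
    0≤D : 0# ≤ D
    0≤D = ∑-nonNegative 0≤1-F
    0≤b : ∀ i → 0# ≤ b i
    0≤b i = +-nonNegative 0≤q (0≤1-F i)
    q≤Fb : ∀ i → q ≤ F i * b i
    q≤Fb i = 0≤y-x⇒x≤y (≤-respʳ-≈
      (solve 2 (λ F q → (:1 :- F) :* (F :- q) := F :* (q :+ (:1 :- F)) :- q) refl (F i) q)
      (*-nonNegative (0≤1-F i) (0≤y-x (q≤F i))))
    Nq≤ : N * q ≤ g * (N * q + D)
    Nq≤ = begin
      N * q                     ≤⟨ am-gm-≤ n (λ i → g * b i) q (λ i → *-nonNegative 0≤g (0≤b i)) (begin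
        q ^ n                     ≈⟨ ∏-const n q ⟨
        ∏ {n} (const q)           ≤⟨ ∏-mono-≤ {n} (λ _ → 0≤q) q≤Fb ⟩
        ∏ (λ i → F i * b i)       ≈⟨ Prod.∑-distrib-+ F b ⟩
        ∏ F * ∏ b                 ≈⟨ *-congʳ (trans (∏-const n g) gⁿ≈∏F) ⟨
        ∏ {n} (const g) * ∏ b     ≈⟨ Prod.∑-distrib-+ {n} (const g) b ⟨
        ∏ (λ i → g * b i)         ∎) ⟩
      ∑ (λ i → g * b i)         ≈⟨ Sum.*-distribˡ-sum g b ⟨
      g * ∑ b                   ≈⟨ *-congˡ (trans (Sum.∑-distrib-+ {n} (const q) (λ i → 1# - F i)) (+-congʳ (∑-const n q))) ⟩
      g * (N * q + D)           ∎

  root-mono : ∀ n → 1 ℕ.≤ n → ∀ {x y} → 0# ≤ y → x ^ n ≤ y ^ n → x ≤ y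
  root-mono (suc n) _ = ^-cancel-≤ n

  replaceFirst-< : ∀ {n} s G (I : Instance n) i → toℕ i ℕ.< s → replaceFirst s G I i ≡ G
  replaceFirst-< s G I i i<s with <?-view (toℕ i) s
  ... | inj₁ (_ , eq) rewrite eq = ≡.refl
  ... | inj₂ (s≤i , _) = contradiction i<s (ℕ.≤⇒≯ s≤i)

  replaceFirst-≥ : ∀ {n} s G (I : Instance n) i → s ℕ.≤ toℕ i → replaceFirst s G I i ≡ I i
  replaceFirst-≥ s G I i s≤i with <?-view (toℕ i) s
  ... | inj₁ (i<s , _) = contradiction i<s (ℕ.≤⇒≯ s≤i)
  ... | inj₂ (_ , eq) rewrite eq = ≡.refl

  toℕ-punchIn-≤ : ∀ {n} (c : Fin (suc n)) k → toℕ (punchIn c k) ℕ.≤ suc (toℕ k)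
  toℕ-punchIn-≤ Fin.zero    k           = ℕ.≤-refl
  toℕ-punchIn-≤ (Fin.suc c) Fin.zero    = ℕ.z≤n
  toℕ-punchIn-≤ (Fin.suc c) (Fin.suc k) = ℕ.s≤s (toℕ-punchIn-≤ c k)

  module _ {n} (I : Instance n) (s : ℕ) (s≤n : s ℕ.≤ n) (G : ℝ → ℝ)
           (proper : ∀ i → Proper (I i))
           (root : ∀ x → IsRoot s (productFirst s s≤n I x) (G x))
           (1≤s : 1 ℕ.≤ s) where

    G-nonNegative : ∀ x → 0# ≤ G x
    G-nonNegative x = IsRoot.nonNegative (root x)

    G≤1 : ∀ x → G x ≤ 1#
    G≤1 x = root-mono s 1≤s 0≤1 (begin
      G x ^ s                            ≈⟨ IsRoot.power (root x) ⟩
      productFirst s s≤n I x             ≤⟨ ∏-mono-≤ {s} (λ i → proj₁ (proper _ x)) (λ i → proj₂ (proper _ x)) ⟩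
      ∏ {s} (const 1#)                   ≈⟨ ∏-const s 1# ⟩
      1# ^ s                             ∎)

    module _ (q : ℝ) (0≤q : 0# ≤ q) (small : ∀ i → toℕ i ℕ.< s → ∀ x → 0# ≤ x → q ≤ I i x) where

      small′ : ∀ i x → 0# ≤ x → q ≤ I (inject≤ i s≤n) x
      small′ i = small (inject≤ i s≤n) (≡.subst (ℕ._< s) (≡.sym (Fin.toℕ-inject≤ i s≤n)) (Fin.toℕ<n i))

      q≤G : ∀ x → 0# ≤ x → q ≤ G x
      q≤G x 0≤x = root-mono s 1≤s (G-nonNegative x) (begin
        q ^ s                     ≈⟨ ∏-const s q ⟨
        ∏ {s} (const q)           ≤⟨ ∏-mono-≤ {s} (λ _ → 0≤q) (λ i → small′ i x 0≤x) ⟩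
        productFirst s s≤n I x    ≈⟨ IsRoot.power (root x) ⟨
        G x ^ s                   ∎)

  module _ {m} (I : Instance (suc m)) (s : ℕ) (s≤m : suc s ℕ.≤ suc m) (G : ℝ → ℝ) (q : ℝ)
           (proper : ∀ i → Proper (I i))
           (root : ∀ x → IsRoot (suc s) (productFirst (suc s) s≤m I x) (G x))
           (0≤q : 0# ≤ q) (q≤1 : q ≤ 1#)
           (small : ∀ i → toℕ i ℕ.< suc s → ∀ x → 0# ≤ x → q ≤ I i x)
           (V : Vector Region (suc m)) (c : Fin (suc m)) (a : ℝ) (0≤a : 0# ≤ a) (Vc : V c ≡ above a)
           (passive : ∀ r → Passive (V (punchIn c r))) where

    private
      1≤s : 1 ℕ.≤ suc s
      1≤s = ℕ.s≤s ℕ.z≤n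
      I′ = replaceFirst (suc s) G I

      0≤G = G-nonNegative I (suc s) s≤m G proper root 1≤s

      proper′ : ∀ i → Proper (I′ i)
      proper′ i with <?-view (toℕ i) (suc s)
      ... | inj₁ (_ , eq) rewrite eq = λ x → 0≤G x , G≤1 I (suc s) s≤m G proper root 1≤s x
      ... | inj₂ (_ , eq) rewrite eq = proper i

    -- The stopping slot `c` is one of the shuffled ones. Of `(s + 1)!`, the factor `s + 1` goes
    -- with one `q` to the sum over the image of `c`, handled by `root-deficit`, and `s !` with the
    -- other `q` to the arrangements of the rest, handled by `permanent-bound`.
    slot-bound-inner : toℕ c ℕ.≤ s →
      fromℕ (suc s !) * (q * q * ∏ (λ i → mass (V i) (I′ i))) ≤
      ∑ (λ k → ∏ (λ i → mass (V i) (I (permsAt s s≤m c k ⟨$⟩ʳ i))))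
    slot-bound-inner c≤s = begin
      fromℕ (suc s !) * (q * q * ∏ (λ i → mass (V i) (I′ i)))
        ≈⟨ *-cong (Mult.×1-homo-* (suc s) (s !)) (*-congˡ product-I′) ⟩
      (fromℕ (suc s) * fromℕ (s !)) * (q * q * ((1# - G a) * ∏ g))
        ≈⟨ solve 5 (λ N M q u P → (N :* M) :* (q :* q :* (u :* P)) := (N :* (q :* u)) :* (M :* (q :* P)))
             refl (fromℕ (suc s)) (fromℕ (s !)) q (1# - G a) (∏ g) ⟩
      (fromℕ (suc s) * (q * (1# - G a))) * W
        ≤⟨ *-monoʳ-≤ 0≤W (root-deficit (suc s) (λ i → I (inject≤ i s≤m) a) (G a) q 0≤q (0≤G a)
             (G≤1 I (suc s) s≤m G proper root 1≤s a)
             (λ i → small′ I (suc s) s≤m G proper root 1≤s q 0≤q small i a 0≤a) (λ i → proj₂ (proper (inject≤ i s≤m) a)) (IsRoot.power (root a))) ⟩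
      ∑ {suc s} u * W
        ≈⟨ Sum.*-distribʳ-sum W u ⟩
      ∑ {suc s} (λ i → u i * W)
        -- With the image `i` fixed, the other slots see a shuffle of the indices different from
        -- `i`: the setting of `permanent-bound` with one index fewer.
        ≤⟨ ∑-mono-≤ {suc s} (λ i → *-monoˡ-≤ (0≤y-x (proj₂ (proper (inject≤ i s≤m) a)))
             (permanent-bound s p′ (f i) g q (λ k r → mass-nonNegative (V (punchIn c k)) (proper _))
                0≤g 0≤q q≤1 (first i) (rest i))) ⟩
      ∑ {suc s} (λ i → u i * ∑ {s !} (λ j → ∏ (λ k → f i k (perms s p′ j ⟨$⟩ʳ k))))
        ≈⟨ Sum.sum-cong-≋ {suc s} (λ i → Sum.*-distribˡ-sum {s !} (u i) (λ j → ∏ (λ k → f i k (perms s p′ j ⟨$⟩ʳ k)))) ⟩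
      ∑ {suc s} (λ i → ∑ {s !} (λ j → u i * ∏ (λ k → f i k (perms s p′ j ⟨$⟩ʳ k))))
        ≈⟨ Sum.sum-cong-≋ {suc s} (λ i → Sum.sum-cong-≋ {s !} (λ j → product-I i j)) ⟨
      ∑ {suc s} (λ i → ∑ {s !} (λ j → ∏ (λ x → mass (V x) (I (inserted s s≤m c (i , j) ⟨$⟩ʳ x)))))
        ≈⟨ Sum₂.sum-remQuot (suc s) (s !) (λ ij → ∏ (λ x → mass (V x) (I (inserted s s≤m c ij ⟨$⟩ʳ x)))) ⟨
      ∑ (λ k → ∏ (λ i → mass (V i) (I (permsAt s s≤m c k ⟨$⟩ʳ i)))) ∎
      where
      p′ : s ℕ.≤ m
      p′ = ℕ.s≤s⁻¹ s≤m
      g : Vector ℝ m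
      g k = mass (V (punchIn c k)) (I′ (punchIn c k))
      0≤g : ∀ k → 0# ≤ g k
      0≤g k = mass-nonNegative (V (punchIn c k)) (proper′ (punchIn c k))
      u : Vector ℝ (suc s)
      u i = 1# - I (inject≤ i s≤m) a
      f : Fin (suc s) → Fin m → Fin m → ℝ
      f i k r = mass (V (punchIn c k)) (I (punchIn (inject≤ i s≤m) r))
      W = fromℕ (s !) * (q * ∏ g)
      0≤W : 0# ≤ W
      0≤W = *-nonNegative (fromℕ-nonNegative (s !)) (*-nonNegative 0≤q (∏-nonNegative 0≤g))

      product-I′ : ∏ (λ i → mass (V i) (I′ i)) ≈ (1# - G a) * ∏ g
      product-I′ = begin-equality
        ∏ (λ i → mass (V i) (I′ i))    ≈⟨ Prod.sum-remove {i = c} (λ i → mass (V i) (I′ i)) ⟩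
        mass (V c) (I′ c) * ∏ g        ≈⟨ *-congʳ (reflexive (≡.cong₂ mass Vc (replaceFirst-< (suc s) G I c (ℕ.s≤s c≤s)))) ⟩
        (1# - G a) * ∏ g               ∎

      product-I : ∀ i j → ∏ (λ x → mass (V x) (I (inserted s s≤m c (i , j) ⟨$⟩ʳ x))) ≈
                          u i * ∏ (λ k → f i k (perms s p′ j ⟨$⟩ʳ k))
      product-I i j = trans (Prod.sum-remove {i = c} (λ x → mass (V x) (I (inserted s s≤m c (i , j) ⟨$⟩ʳ x))))
        (*-cong (reflexive (≡.cong₂ (λ v x → mass v (I x)) Vc (insert-self c (inject≤ i s≤m) (perms s p′ j))))
                (Prod.sum-cong-≋ λ k → reflexive (≡.cong (λ x → mass (V (punchIn c k)) (I x))
                  (Perm.insert-punchIn c (inject≤ i s≤m) (perms s p′ j) k))))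

      first : ∀ i k → toℕ k ℕ.< s → q * g k ^ s ≤ ∏ {s} (λ r → f i k (inject≤ r p′))
      first i k k<s with V (punchIn c k) | passive k
      ... | everything | everything = begin
        q * 1# ^ s           ≤⟨ *-mono-≤ 0≤q 0≤1 q≤1 (≤-reflexive (1^n≈1 s)) ⟩
        1# * 1#              ≈⟨ *-identityˡ 1# ⟩
        1#                   ≈⟨ ∏-one s ⟨
        ∏ {s} (const 1#)     ∎
      ... | atMost b | atMost 0≤b
        rewrite replaceFirst-< (suc s) G I (punchIn c k) (ℕ.s≤s (ℕ.≤-trans (toℕ-punchIn-≤ c k) k<s)) = begin
        q * G b ^ s                                    ≤⟨ *-monoʳ-≤ (^-nonNegative s (0≤G b)) (q≤G I (suc s) s≤m G proper root 1≤s q 0≤q small b 0≤b) ⟩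
        G b ^ suc s                                    ≈⟨ IsRoot.power (root b) ⟩
        ∏ {suc s} h                                    ≈⟨ Prod.sum-remove {i = i} h ⟩
        h i * ∏ {s} (λ r → h (punchIn i r))            ≤⟨ *-monoʳ-≤ (∏-nonNegative {s} λ r → proj₁ (proper _ b)) (proj₂ (proper _ b)) ⟩
        1# * ∏ {s} (λ r → h (punchIn i r))             ≈⟨ *-identityˡ _ ⟩
        ∏ {s} (λ r → h (punchIn i r))                  ≈⟨ Prod.sum-cong-≋ {s} (λ r → reflexive (≡.cong (λ x → I x b) (punchIn-inject≤ s≤m i r))) ⟨
        ∏ {s} (λ r → I (punchIn (inject≤ i s≤m) (inject≤ r p′)) b) ∎
        where
        h : Vector ℝ (suc s)
        h r = I (inject≤ r s≤m) b

      rest : ∀ i k → s ℕ.≤ toℕ k → g k ≤ f i k k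
      rest i k s≤k = ≤-reflexive (reflexive (≡.cong (mass (V (punchIn c k))) (≡.trans
        (≡.cong I′ (punchIn-≤ c k (ℕ.≤-trans c≤s s≤k)))
        (≡.trans (replaceFirst-≥ (suc s) G I (Fin.suc k) (ℕ.s≤s s≤k))
          (≡.cong I (≡.sym (punchIn-≤ (inject≤ i s≤m) k (ℕ.≤-trans (toℕ-inject≤-≤ s≤m i) s≤k))))))))

    -- Now the stopping slot keeps its own distribution and every shuffled slot is passive, so
    -- `permanent-bound` applies with loss 1. The factor `q * q ≤ 1` is given away to match the
    -- other case.
    slot-bound-outer : suc s ℕ.≤ toℕ c →
      fromℕ (suc s !) * (q * q * ∏ (λ i → mass (V i) (I′ i))) ≤
      ∑ (λ k → ∏ (λ i → mass (V i) (I (perms (suc s) s≤m k ⟨$⟩ʳ i))))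
    slot-bound-outer s<c = ≤-trans
      (*-monoˡ-≤ (fromℕ-nonNegative (suc s !)) (*-monoʳ-≤ (∏-nonNegative λ i → mass-nonNegative (V i) (proper′ i))
        (≤-trans (*-mono-≤ 0≤q 0≤1 q≤1 q≤1) (≤-reflexive (*-identityˡ 1#)))))
      (permanent-bound (suc s) s≤m (λ k r → mass (V k) (I r)) (λ k → mass (V k) (I′ k)) 1#
        (λ k r → mass-nonNegative (V k) (proper r)) (λ k → mass-nonNegative (V k) (proper′ k)) 0≤1 ≤-refl first rest)
      where
      passive′ : ∀ k → k ≢ c → Passive (V k)
      passive′ k k≢c = ≡.subst (Passive ∘ V) (Fin.punchIn-punchOut (k≢c ∘ ≡.sym)) (passive (Fin.punchOut (k≢c ∘ ≡.sym)))
      first : ∀ k → toℕ k ℕ.< suc s → 1# * mass (V k) (I′ k) ^ suc s ≤ ∏ {suc s} (λ r → mass (V k) (I (inject≤ r s≤m)))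
      first k k<s with V k | passive′ k (λ { ≡.refl → ℕ.<⇒≱ k<s s<c })
      ... | everything | everything = ≤-reflexive (trans (*-identityˡ _) (trans (1^n≈1 (suc s)) (sym (∏-one (suc s)))))
      ... | atMost b | atMost 0≤b rewrite replaceFirst-< (suc s) G I k k<s =
        ≤-reflexive (trans (*-identityˡ _) (IsRoot.power (root b)))
      rest : ∀ k → suc s ℕ.≤ toℕ k → mass (V k) (I′ k) ≤ mass (V k) (I k)
      rest k s≤k = ≤-reflexive (reflexive (≡.cong (mass (V k)) (replaceFirst-≥ (suc s) G I k s≤k)))

-- Elementary measure theory and the comparison of integrals through tails.

module Measure (em : ExcludedMiddle (Level.suc 0ℓ)) (R : RealField) (P : Real.ProbabilitySpace R) where

  open OrderedField R
  open SumsAndProducts R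
  open Probability P
  open Solver using (solve; _:=_; _:+_; _:*_; _:-_; :0; :1)
  open import Data.Nat.Base using (zero; suc)
  open ≤-Reasoning

  classical : (A : Set) → Dec A
  classical A with em {Level.Lift _ A}
  ... | yes a = yes (Level.lower a)
  ... | no ¬a = no (¬a ∘ Level.lift)

  ≐-sym : ∀ {A : Set} {B C : Pred A 0ℓ} → B ≐ C → C ≐ B
  ≐-sym (f , g) = g , f

  -- Pads two sets to a sequence, as the axioms speak of countable unions.
  pair : ∀ {A : Set} → Pred A 0ℓ → Pred A 0ℓ → ℕ → Pred A 0ℓ
  pair A B zero          = A
  pair A B (suc zero)    = B
  pair A B (suc (suc _)) = ∅

  pair-⋃ : ∀ {A : Set} {B C : Pred A 0ℓ} → ⋃ ℕ (pair B C) ≐ B ∪ C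
  pair-⋃ = (λ { (zero , b) → inj₁ b ; (suc zero , c) → inj₂ c }) , λ { (inj₁ b) → 0 , b ; (inj₂ c) → 1 , c }

  measurable-∅ : Measurable ∅
  measurable-∅ = m-resp ((λ ¬u → ¬u tt) , λ ()) (m-complement m-universe)

  measurable-pair : ∀ {A B} → Measurable A → Measurable B → ∀ k → Measurable (pair A B k)
  measurable-pair mA mB zero          = mA
  measurable-pair mA mB (suc zero)    = mB
  measurable-pair mA mB (suc (suc _)) = measurable-∅

  measurable-∪ : ∀ {A B} → Measurable A → Measurable B → Measurable (A ∪ B)
  measurable-∪ mA mB = m-resp pair-⋃ (m-union (measurable-pair mA mB))

  ∁∁-≐ : ∀ {A : Set} (B : Pred A 0ℓ) → ∁ (∁ B) ≐ B
  ∁∁-≐ B = (λ {x} ¬¬b → dne (classical (B x)) ¬¬b) , λ b ¬b → ¬b b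
    where
    dne : ∀ {C : Set} → Dec C → ¬ ¬ C → C
    dne (yes c) _   = c
    dne (no ¬c) ¬¬c = contradiction ¬c ¬¬c

  measurable-∩ : ∀ {A B} → Measurable A → Measurable B → Measurable (A ∩ B)
  measurable-∩ {A} {B} mA mB = m-resp
    ( (λ {ω} h → proj₁ (∁∁-≐ A) (h ∘ inj₁) , proj₁ (∁∁-≐ B) (h ∘ inj₂))
    , (λ { (a , b) (inj₁ ¬a) → ¬a a ; (a , b) (inj₂ ¬b) → ¬b b }))
    (m-complement (measurable-∪ (m-complement mA) (m-complement mB)))

  measurable-∀ : ∀ {n} {A : Vector (Pred Ω 0ℓ) n} → (∀ i → Measurable (A i)) → Measurable (λ ω → ∀ i → A i ω)
  measurable-∀ {zero}  mA = m-resp ((λ _ ()) , λ _ → tt) m-universe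
  measurable-∀ {suc n} mA = m-resp
    ((λ { (a , as) Fin.zero → a ; (a , as) (Fin.suc i) → as i }) , λ as → as Fin.zero , as ∘ Fin.suc)
    (measurable-∩ (mA Fin.zero) (measurable-∀ (mA ∘ Fin.suc)))

  measurable-∃ : ∀ {n} {A : Vector (Pred Ω 0ℓ) n} → (∀ i → Measurable (A i)) → Measurable (λ ω → ∃ λ i → A i ω)
  measurable-∃ {zero}  mA = m-resp ((λ ()) , λ ()) measurable-∅
  measurable-∃ {suc n} mA = m-resp
    ( (λ { (inj₁ a) → Fin.zero , a ; (inj₂ (i , a)) → Fin.suc i , a })
    , (λ { (Fin.zero , a) → inj₁ a ; (Fin.suc i , a) → inj₂ (i , a) }))
    (measurable-∪ (mA Fin.zero) (measurable-∃ (mA ∘ Fin.suc)))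

  limit-eventually-constant : ∀ {a l c} N → (∀ m → N ℕ.≤ m → a m ≈ c) → ConvergesTo a l → l ≈ c
  limit-eventually-constant {a} {l} {c} N a≈c conv = antisym (≮⇒≥ c≮l) (≮⇒≥ l≮c)
    where
    c≮l : ¬ c < l
    c≮l c<l with conv (l - c) (0<y-x c<l)
    ... | M , close = <-irrefl (solve 2 (λ l c → l :- (l :- c) := c) refl l c) (<-respʳ-≈ (a≈c _ (ℕ.m≤m⊔n N M)) (proj₁ (close (N ℕ.⊔ M) (ℕ.m≤n⊔m N M))))
    l≮c : ¬ l < c
    l≮c l<c with conv (c - l) (0<y-x l<c)
    ... | M , close = <-irrefl (solve 2 (λ l c → c := l :+ (c :- l)) refl l c) (<-respˡ-≈ (a≈c _ (ℕ.m≤m⊔n N M)) (proj₂ (close (N ℕ.⊔ M) (ℕ.m≤n⊔m N M))))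

  -- Countably many copies of the empty set are disjoint, so the multiples of `p = ℙ ∅` converge to
  -- `p`. A positive `p`, taken as the tolerance, is refuted by the multiples from the second on.
  ℙ-∅ : ℙ ∅ ≈ 0#
  ℙ-∅ = antisym (≮⇒≥ 0≮p) (ℙ-nonNegative measurable-∅)
    where
    p = ℙ ∅
    conv : ConvergesTo (λ N → ∑ {N} (const p)) (ℙ (⋃ ℕ (λ _ → ∅)))
    conv = ℙ-additive (λ _ → measurable-∅) (λ _ _ _ ())
    p≈ : ℙ (⋃ ℕ (λ _ → ∅)) ≈ p
    p≈ = sym (ℙ-cong measurable-∅ ((λ ()) , λ ()))
    0≮p : ¬ 0# < p
    0≮p 0<p with conv p 0<p
    ... | M , close = <⇒≱ (proj₂ (close (2 ℕ.+ M) (ℕ.m≤n+m M 2))) (begin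
      ℙ (⋃ ℕ (λ _ → ∅)) + p        ≈⟨ +-congʳ p≈ ⟩
      p + p                        ≈⟨ +-congˡ (+-identityʳ p) ⟨
      p + (p + 0#)                 ≤⟨ +-monoʳ-≤ p (+-monoʳ-≤ p (∑-nonNegative {M} (λ _ → <⇒≤ 0<p))) ⟩
      p + (p + ∑ {M} (const p))    ∎)

  ℙ-∪ : ∀ {A B} → Measurable A → Measurable B → A ⊥ B → ℙ (A ∪ B) ≈ ℙ A + ℙ B
  ℙ-∪ {A} {B} mA mB A⊥B = begin-equality
    ℙ (A ∪ B)          ≈⟨ ℙ-cong (measurable-∪ mA mB) (≐-sym pair-⋃) ⟩
    ℙ (⋃ ℕ (pair A B)) ≈⟨ limit-eventually-constant 2 sums (ℙ-additive (measurable-pair mA mB) disjoint) ⟩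
    ℙ A + ℙ B          ∎
    where
    disjoint : ∀ j k → j ≢ k → pair A B j ⊥ pair A B k
    disjoint zero          zero          j≢k _       = j≢k ≡.refl
    disjoint (suc zero)    (suc zero)    j≢k _       = j≢k ≡.refl
    disjoint zero          (suc zero)    j≢k (a , b) = A⊥B (a , b)
    disjoint (suc zero)    zero          j≢k (b , a) = A⊥B (a , b)
    disjoint (suc (suc j)) k             j≢k (() , _)
    disjoint zero          (suc (suc k)) j≢k (_ , ())
    disjoint (suc zero)    (suc (suc k)) j≢k (_ , ())
    sums : ∀ m → 2 ℕ.≤ m → ∑ {m} (λ k → ℙ (pair A B (toℕ k))) ≈ ℙ A + ℙ B
    sums (suc (suc m)) _ = +-congˡ (begin-equality
      ℙ B + ∑ {m} (const (ℙ ∅))    ≈⟨ +-congˡ (Sum.sum-cong-≋ {m} (λ _ → ℙ-∅)) ⟩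
      ℙ B + ∑ {m} (const 0#)       ≈⟨ +-congˡ (Sum.sum-replicate-zero m) ⟩
      ℙ B + 0#                     ≈⟨ +-identityʳ _ ⟩
      ℙ B                          ∎)
    sums (suc zero) (ℕ.s≤s ())

  ℙ-split : ∀ {A B} → Measurable A → Measurable B → ℙ A ≈ ℙ (A ∩ B) + ℙ (A ∩ ∁ B)
  ℙ-split {A} {B} mA mB = begin-equality
    ℙ A                          ≈⟨ ℙ-cong mA (to , λ { (inj₁ ab) → proj₁ ab ; (inj₂ ab) → proj₁ ab }) ⟩
    ℙ ((A ∩ B) ∪ (A ∩ ∁ B))      ≈⟨ ℙ-∪ (measurable-∩ mA mB) (measurable-∩ mA (m-complement mB)) (λ { ((_ , b) , (_ , ¬b)) → ¬b b }) ⟩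
    ℙ (A ∩ B) + ℙ (A ∩ ∁ B)      ∎
    where
    to : A ⊆ (A ∩ B) ∪ (A ∩ ∁ B)
    to {ω} a with classical (B ω)
    ... | yes b = inj₁ (a , b)
    ... | no ¬b = inj₂ (a , ¬b)

  ℙ-mono : ∀ {A B} → Measurable A → Measurable B → A ⊆ B → ℙ A ≤ ℙ B
  ℙ-mono {A} {B} mA mB A⊆B = begin
    ℙ A                        ≈⟨ ℙ-cong mA ((λ a → A⊆B a , a) , proj₂) ⟩
    ℙ (B ∩ A)                  ≈⟨ +-identityʳ _ ⟨
    ℙ (B ∩ A) + 0#             ≤⟨ +-monoʳ-≤ _ (ℙ-nonNegative (measurable-∩ mB (m-complement mA))) ⟩
    ℙ (B ∩ A) + ℙ (B ∩ ∁ A)    ≈⟨ ℙ-split mB mA ⟨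
    ℙ B                        ∎

  ℙ-∃ : ∀ {n} {A : Vector (Pred Ω 0ℓ) n} → (∀ i → Measurable (A i)) → (∀ i j → i ≢ j → A i ⊥ A j) →
        ℙ (λ ω → ∃ λ i → A i ω) ≈ ∑ (λ i → ℙ (A i))
  ℙ-∃ {zero}      mA disjoint = trans (ℙ-cong (measurable-∃ {zero} (λ ())) ((λ ()) , λ ())) ℙ-∅
  ℙ-∃ {suc n} {A} mA disjoint = begin-equality
    ℙ (λ ω → ∃ λ i → A i ω)
      ≈⟨ ℙ-cong (measurable-∃ mA)
           ( (λ { (Fin.zero , a) → inj₁ a ; (Fin.suc i , a) → inj₂ (i , a) })
           , (λ { (inj₁ a) → Fin.zero , a ; (inj₂ (i , a)) → Fin.suc i , a })) ⟩
    ℙ (A Fin.zero ∪ (λ ω → ∃ λ i → A (Fin.suc i) ω))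
      ≈⟨ ℙ-∪ (mA Fin.zero) (measurable-∃ (mA ∘ Fin.suc)) (λ { (a , (i , b)) → disjoint Fin.zero (Fin.suc i) (λ ()) (a , b) }) ⟩
    ℙ (A Fin.zero) + ℙ (λ ω → ∃ λ i → A (Fin.suc i) ω)
      ≈⟨ +-congˡ (ℙ-∃ (mA ∘ Fin.suc) (λ i j i≢j → disjoint (Fin.suc i) (Fin.suc j) (i≢j ∘ Fin.suc-injective))) ⟩
    ∑ (λ i → ℙ (A i)) ∎

  -- The weights select a subfamily without reindexing; later they are the indicators of the
  -- coefficients that reach a level. The induction removes each selected set from `B`, where
  -- disjointness keeps the others inside.
  ∑-disjoint-≤ : ∀ {n} (A : Vector (Pred Ω 0ℓ) n) (w : Vector ℝ n) {B} → (∀ i → Measurable (A i)) → Measurable B →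
                 (∀ i j → i ≢ j → A i ⊥ A j) → (∀ i → (w i ≈ 0#) ⊎ ((w i ≈ 1#) × (A i ⊆ B))) →
                 ∑ (λ i → ℙ (A i) * w i) ≤ ℙ B
  ∑-disjoint-≤ {zero}  A w     mA mB disjoint included = ℙ-nonNegative mB
  ∑-disjoint-≤ {suc n} A w {B} mA mB disjoint included with included Fin.zero
  ... | inj₁ w≈0 = begin
    ℙ (A Fin.zero) * w Fin.zero + S   ≈⟨ +-congʳ (trans (*-congˡ w≈0) (zeroʳ _)) ⟩
    0# + S                            ≈⟨ +-identityˡ S ⟩
    S                                 ≤⟨ ∑-disjoint-≤ (A ∘ Fin.suc) (w ∘ Fin.suc) (mA ∘ Fin.suc) mB
                                          (λ i j i≢j → disjoint (Fin.suc i) (Fin.suc j) (i≢j ∘ Fin.suc-injective)) (included ∘ Fin.suc) ⟩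
    ℙ B                               ∎
    where
    S = ∑ (λ i → ℙ (A (Fin.suc i)) * w (Fin.suc i))
  ... | inj₂ (w≈1 , A₀⊆B) = begin
    ℙ (A Fin.zero) * w Fin.zero + S   ≈⟨ +-congʳ (trans (*-congˡ w≈1) (*-identityʳ _)) ⟩
    ℙ (A Fin.zero) + S                ≤⟨ +-mono-≤ (ℙ-mono (mA Fin.zero) (measurable-∩ mB (mA Fin.zero)) (λ a → A₀⊆B a , a)) (
      ∑-disjoint-≤ (A ∘ Fin.suc) (w ∘ Fin.suc) (mA ∘ Fin.suc) (measurable-∩ mB (m-complement (mA Fin.zero)))
        (λ i j i≢j → disjoint (Fin.suc i) (Fin.suc j) (i≢j ∘ Fin.suc-injective)) included′) ⟩
    ℙ (B ∩ A Fin.zero) + ℙ (B ∩ ∁ (A Fin.zero)) ≈⟨ ℙ-split mB (mA Fin.zero) ⟨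
    ℙ B                               ∎
    where
    S = ∑ (λ i → ℙ (A (Fin.suc i)) * w (Fin.suc i))
    included′ : ∀ i → (w (Fin.suc i) ≈ 0#) ⊎ ((w (Fin.suc i) ≈ 1#) × (A (Fin.suc i) ⊆ B ∩ ∁ (A Fin.zero)))
    included′ i with included (Fin.suc i)
    ... | inj₁ w≈0         = inj₁ w≈0
    ... | inj₂ (w≈1 , A⊆B) = inj₂ (w≈1 , λ a → A⊆B a , λ a₀ → disjoint Fin.zero (Fin.suc i) (λ ()) (a₀ , a))

  -- The lower Riemann sum of a decreasing `h` over sorted levels, every layer taking the value at
  -- its upper end. For `h` a tail probability this is the layer-cake formula.
  layerSum : ℝ → List ℝ → (ℝ → ℝ) → ℝ
  layerSum base []       h = 0#
  layerSum base (d ∷ ds) h = (d - base) * h d + layerSum d ds h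

  indicator : ℝ → ℝ → ℝ
  indicator d c = if does (d ≤? c) then 1# else 0#

  indicator-yes : ∀ {d c} → d ≤ c → indicator d c ≈ 1#
  indicator-yes {d} {c} d≤c rewrite dec-true (d ≤? c) d≤c = refl

  indicator-view : ∀ d c → (indicator d c ≈ 0#) ⊎ ((indicator d c ≈ 1#) × d ≤ c)
  indicator-view d c with d ≤? c
  ... | yes d≤c = inj₂ (refl , d≤c)
  ... | no _    = inj₁ refl

  indicator-nonNegative : ∀ d c → 0# ≤ indicator d c
  indicator-nonNegative d c with d ≤? c
  ... | yes _ = 0≤1
  ... | no _  = ≤-refl

  layerSum-nonNegative : ∀ {base ds h} → Linked _≤_ (base ∷ ds) → (∀ d → 0# ≤ h d) → 0# ≤ layerSum base ds h
  layerSum-nonNegative [-]                 0≤h = ≤-refl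
  layerSum-nonNegative (base≤d Linked.∷ l) 0≤h =
    +-nonNegative (*-nonNegative (0≤y-x base≤d) (0≤h _)) (layerSum-nonNegative l 0≤h)

  -- A level `d ≤ 0` above a nonnegative `base` closes a layer of thickness zero. Comparing only
  -- positive levels matters because `θ * d < d` fails at zero.
  layerSum-mono-≤ : ∀ {base ds h h′} → 0# ≤ base → Linked _≤_ (base ∷ ds) → (∀ d → 0# < d → h d ≤ h′ d) →
                    layerSum base ds h ≤ layerSum base ds h′
  layerSum-mono-≤ 0≤base [-] h≤h′ = ≤-refl
  layerSum-mono-≤ {base} {d ∷ ds} {h} {h′} 0≤base (base≤d Linked.∷ l) h≤h′ =
    +-mono-≤ layer (layerSum-mono-≤ (≤-trans 0≤base base≤d) l h≤h′)
    where
    layer : (d - base) * h d ≤ (d - base) * h′ d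
    layer with d ≤? 0#
    ... | no d≰0  = *-monoˡ-≤ (0≤y-x base≤d) (h≤h′ d (≰⇒> d≰0))
    ... | yes d≤0 = ≤-reflexive (trans (trans (*-congʳ d-base≈0) (zeroˡ _)) (sym (trans (*-congʳ d-base≈0) (zeroˡ _))))
      where
      d-base≈0 : d - base ≈ 0#
      d-base≈0 = antisym (≤-trans (x-y≤x 0≤base) d≤0) (0≤y-x base≤d)

  layerSum-* : ∀ base ds q h → q * layerSum base ds h ≈ layerSum base ds (λ d → q * h d)
  layerSum-* base []       q h = zeroʳ q
  layerSum-* base (d ∷ ds) q h = begin-equality
    q * ((d - base) * h d + layerSum d ds h)      ≈⟨ solve 4 (λ q e h l → q :* (e :* h :+ l) := e :* (q :* h) :+ q :* l) refl q (d - base) (h d) (layerSum d ds h) ⟩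
    (d - base) * (q * h d) + q * layerSum d ds h  ≈⟨ +-congˡ (layerSum-* d ds q h) ⟩
    (d - base) * (q * h d) + layerSum d ds (λ d → q * h d) ∎

  layerSum-∑ : ∀ {n} base ds (h : Fin n → ℝ → ℝ) →
               ∑ (λ k → layerSum base ds (h k)) ≈ layerSum base ds (λ d → ∑ (λ k → h k d))
  layerSum-∑ {n} base []       h = Sum.sum-replicate-zero n
  layerSum-∑ {n} base (d ∷ ds) h = begin-equality
    ∑ (λ k → (d - base) * h k d + layerSum d ds (h k))
      ≈⟨ Sum.∑-distrib-+ (λ k → (d - base) * h k d) (λ k → layerSum d ds (h k)) ⟩
    ∑ (λ k → (d - base) * h k d) + ∑ (λ k → layerSum d ds (h k))
      ≈⟨ +-cong (sym (Sum.*-distribˡ-sum (d - base) (λ k → h k d))) (layerSum-∑ d ds h) ⟩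
    (d - base) * ∑ (λ k → h k d) + layerSum d ds (λ d → ∑ (λ k → h k d)) ∎

  -- Up to `c` every indicator is 1, and the thicknesses of the layers telescope.
  layerSum-indicator : ∀ {base ds c} → Linked _≤_ (base ∷ ds) → c ∈ˡ ds →
                       c ≤ base + layerSum base ds (λ d → indicator d c)
  layerSum-indicator {base} {d ∷ ds} {c} (base≤d Linked.∷ l) c∈ = begin
    c                                            ≤⟨ bound c∈ ⟩
    d + rest                                     ≈⟨ solve 3 (λ b d r → d :+ r := b :+ ((d :- b) :* :1 :+ r)) refl base d rest ⟩
    base + ((d - base) * 1# + rest)              ≈⟨ +-congˡ (+-congʳ (*-congˡ (indicator-yes (d≤c c∈)))) ⟨
    base + ((d - base) * indicator d c + rest)   ∎
    where
    rest = layerSum d ds (λ d → indicator d c)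
    d≤c : c ∈ˡ d ∷ ds → d ≤ c
    d≤c (here ≡.refl) = ≤-refl
    d≤c (there c∈ds)  = All.lookup (All.tail (Linked⇒All ≤-trans ≤-refl l)) c∈ds
    bound : c ∈ˡ d ∷ ds → c ≤ d + rest
    bound (here ≡.refl) = ≤-respˡ-≈ (+-identityʳ d) (+-monoʳ-≤ d (layerSum-nonNegative l (λ e → indicator-nonNegative e d)))
    bound (there c∈ds)  = layerSum-indicator l c∈ds

  MeasurableTails : (Ω → ℝ) → Set (Level.suc 0ℓ)
  MeasurableTails f = ∀ x → 0# ≤ x → Measurable (λ ω → x < f ω)

  -- The simple function rounds `f` down to the levels multiplied by `θ`, band by band. A band has
  -- the difference of two tails as its probability, so summation by parts yields the layer sum. The
  -- support clause keeps the lowest band disjoint from those above it.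
  layered : ∀ {f} θ {base ds} → MeasurableTails f → 0# ≤ θ → 0# ≤ base → Linked _≤_ (base ∷ ds) →
    Σ (SimpleBelow f) λ ψ →
      (∀ k → SimpleBelow.set ψ k ⊆ (λ ω → θ * base < f ω)) ×
      (SimpleBelow.integral ψ ≈
        θ * base * ℙ (λ ω → θ * base < f ω) + θ * layerSum base ds (λ d → ℙ (λ ω → θ * d < f ω)))
  layered {f} θ {base} {[]} mf 0≤θ 0≤base l = record
    { size = 1 ; set = λ _ ω → θ * base < f ω ; coefficient = λ _ → θ * base
    ; measurable = λ _ → mf _ 0≤θbase
    ; disjoint = λ { Fin.zero Fin.zero j≢k → contradiction ≡.refl j≢k }
    ; nonNegative = λ _ → 0≤θbase ; below = λ _ → <⇒≤ } ,
    (λ _ p → p) , +-congˡ (sym (zeroʳ θ))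
    where
    0≤θbase = *-nonNegative 0≤θ 0≤base
  layered {f} θ {base} {d ∷ ds} mf 0≤θ 0≤base (base≤d Linked.∷ l) = record
    { size = suc ψ.size ; set = sets ; coefficient = coefficients
    ; measurable = λ { Fin.zero → measurable-∩ mbase (m-complement md) ; (Fin.suc k) → ψ.measurable k }
    ; disjoint = disjoint
    ; nonNegative = λ { Fin.zero → 0≤θbase ; (Fin.suc k) → ψ.nonNegative k }
    ; below = λ { Fin.zero (p , _) → <⇒≤ p ; (Fin.suc k) → ψ.below k } } ,
    support , (begin-equality
      θ * base * ℙ band + ψ.integral
        ≈⟨ +-congˡ (proj₂ (proj₂ ψ,support,integral)) ⟩
      θ * base * ℙ band + (θ * d * p d + θ * L)
        ≈⟨ solve 6 (λ t b c d p L → t :* b :* c :+ (t :* d :* p :+ t :* L) := t :* b :* (p :+ c) :+ t :* ((d :- b) :* p :+ L))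
             refl θ base (ℙ band) d (p d) L ⟩
      θ * base * (p d + ℙ band) + θ * ((d - base) * p d + L)
        ≈⟨ +-congʳ (*-congˡ (trans (+-congʳ (ℙ-cong md ((λ q → ≤-<-trans θbase≤θd q , q) , proj₂))) (sym (ℙ-split mbase md)))) ⟩
      θ * base * p base + θ * ((d - base) * p d + L) ∎)
    where
    p : ℝ → ℝ
    p e = ℙ (λ ω → θ * e < f ω)
    L = layerSum d ds p
    0≤θbase = *-nonNegative 0≤θ 0≤base
    θbase≤θd : θ * base ≤ θ * d
    θbase≤θd = *-monoˡ-≤ 0≤θ base≤d
    mbase : Measurable (λ ω → θ * base < f ω)
    mbase = mf _ 0≤θbase
    md : Measurable (λ ω → θ * d < f ω)
    md = mf _ (≤-trans 0≤θbase θbase≤θd)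
    ψ,support,integral = layered θ mf 0≤θ (≤-trans 0≤base base≤d) l
    module ψ = SimpleBelow (proj₁ ψ,support,integral)
    band : Pred Ω 0ℓ
    band = (λ ω → θ * base < f ω) ∩ ∁ (λ ω → θ * d < f ω)
    sets : Vector (Pred Ω 0ℓ) (suc ψ.size)
    sets Fin.zero    = band
    sets (Fin.suc k) = ψ.set k
    coefficients : Vector ℝ (suc ψ.size)
    coefficients Fin.zero    = θ * base
    coefficients (Fin.suc k) = ψ.coefficient k
    disjoint : ∀ j k → j ≢ k → sets j ⊥ sets k
    disjoint Fin.zero    Fin.zero    j≢k _               = j≢k ≡.refl
    disjoint Fin.zero    (Fin.suc k) j≢k ((_ , ¬d) , a)  = ¬d (proj₁ (proj₂ ψ,support,integral) k a)
    disjoint (Fin.suc j) Fin.zero    j≢k (a , (_ , ¬d))  = ¬d (proj₁ (proj₂ ψ,support,integral) j a)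
    disjoint (Fin.suc j) (Fin.suc k) j≢k                 = ψ.disjoint j k (j≢k ∘ ≡.cong Fin.suc)
    support : ∀ k → sets k ⊆ (λ ω → θ * base < f ω)
    support Fin.zero    (q , _) = q
    support (Fin.suc k) a       = ≤-<-trans θbase≤θd (proj₁ (proj₂ ψ,support,integral) k a)

  -- Otherwise some `z` lies strictly between `b` and `y`, and the ratio of `z` to `y` is a `θ` that
  -- violates the hypothesis.
  scaled-bound : ∀ {y b} → 0# ≤ b → (∀ θ → 0# ≤ θ → θ < 1# → θ * y ≤ b) → y ≤ b
  scaled-bound {y} {b} 0≤b bound with y ≤? b
  ... | yes y≤b = y≤b
  ... | no y≰b  = contradiction (≤-respˡ-≈ θy≈z (bound θ 0≤θ θ<1)) (<⇒≱ b<z)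
    where
    between = <-dense (≰⇒> y≰b)
    z = proj₁ between
    b<z = proj₁ (proj₂ between)
    z<y = proj₂ (proj₂ between)
    0<y = ≤-<-trans 0≤b (≰⇒> y≰b)
    θ = z * y ⁻¹
    0≤θ = *-nonNegative (≤-trans 0≤b (<⇒≤ b<z)) (<⇒≤ (⁻¹-positive 0<y))
    θy≈z : θ * y ≈ z
    θy≈z = begin-equality
      z * y ⁻¹ * y     ≈⟨ solve 3 (λ z w y → z :* w :* y := z :* (y :* w)) refl z (y ⁻¹) y ⟩
      z * (y * y ⁻¹)   ≈⟨ *-congˡ (⁻¹-inverse (<⇒≉0 0<y)) ⟩
      z * 1#           ≈⟨ *-identityʳ z ⟩
      z                ∎
    θ<1 : θ < 1#
    θ<1 = ≰⇒> λ 1≤θ → <⇒≱ z<y (begin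
      y        ≈⟨ *-identityˡ y ⟨
      1# * y   ≤⟨ *-monoʳ-≤ (<⇒≤ 0<y) 1≤θ ⟩
      θ * y    ≈⟨ θy≈z ⟩
      z        ∎)

  integral-nonNegative : ∀ {f} (φ : SimpleBelow f) → 0# ≤ SimpleBelow.integral φ
  integral-nonNegative φ = ∑-nonNegative λ k → *-nonNegative (φ.nonNegative k) (ℙ-nonNegative (φ.measurable k))
    where module φ = SimpleBelow φ

  -- The factor θ < 1 makes room between the weak inequality below a simple function and strict tails.
  tail-comparison : ∀ {f g} q b → MeasurableTails f → MeasurableTails g → 0# ≤ q →
    (∀ x → 0# ≤ x → q * ℙ (λ ω → x < g ω) ≤ ℙ (λ ω → x < f ω)) →
    (∀ (ψ : SimpleBelow f) → SimpleBelow.integral ψ ≤ b) →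
    ∀ (φ : SimpleBelow g) → q * SimpleBelow.integral φ ≤ b
  tail-comparison {f} {g} q b mf mg 0≤q tails bound φ =
    scaled-bound (≤-trans (integral-nonNegative (proj₁ (ψ₀))) (bound (proj₁ ψ₀))) λ θ 0≤θ θ<1 → begin
      θ * (q * φ.integral)
        ≤⟨ *-monoˡ-≤ 0≤θ (*-monoˡ-≤ 0≤q (integral≤ θ 0≤θ θ<1)) ⟩
      θ * (q * layerSum 0# ds (λ d → ℙ (λ ω → θ * d < g ω)))
        ≈⟨ *-congˡ (layerSum-* 0# ds q _) ⟩
      θ * layerSum 0# ds (λ d → q * ℙ (λ ω → θ * d < g ω))
        ≤⟨ *-monoˡ-≤ 0≤θ (layerSum-mono-≤ ≤-refl linked (λ d 0<d → tails (θ * d) (*-nonNegative 0≤θ (<⇒≤ 0<d)))) ⟩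
      θ * layerSum 0# ds (λ d → ℙ (λ ω → θ * d < f ω))
        -- The levels start from base zero, so the lowest band contributes nothing.
        ≈⟨ solve 3 (λ t p l → t :* l := t :* :0 :* p :+ t :* l) refl θ (ℙ (λ ω → θ * 0# < f ω)) _ ⟩
      θ * 0# * ℙ (λ ω → θ * 0# < f ω) + θ * layerSum 0# ds (λ d → ℙ (λ ω → θ * d < f ω))
        ≈⟨ proj₂ (proj₂ (layered θ mf 0≤θ ≤-refl linked)) ⟨
      SimpleBelow.integral (proj₁ (layered θ mf 0≤θ ≤-refl linked))
        ≤⟨ bound (proj₁ (layered θ mf 0≤θ ≤-refl linked)) ⟩
      b ∎
    where
    module φ = SimpleBelow φ
    module Sort = Data.List.Sort decTotalOrder
    cs = tabulate φ.coefficient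
    ds = Sort.sort cs
    0≤ds : All (0# ≤_) ds
    0≤ds = All-resp-↭ (↭-sym (Sort.sort-↭ cs)) (All.tabulate⁺ φ.nonNegative)
    link : ∀ {es} → All (0# ≤_) es → Linked _≤_ es → Linked _≤_ (0# ∷ es)
    link All.[]          _ = [-]
    link (0≤e All.∷ _)   l = 0≤e Linked.∷ l
    linked : Linked _≤_ (0# ∷ ds)
    linked = link 0≤ds (Sort.sort-↗ cs)
    -- Some simple function below `f` is required to see that `b` is nonnegative; the scale zero
    -- gives one.
    ψ₀ = layered 0# mf ≤-refl ≤-refl linked
    coefficient≤ : ∀ k → φ.coefficient k ≤ layerSum 0# ds (λ d → indicator d (φ.coefficient k))
    coefficient≤ k = ≤-respʳ-≈ (+-identityˡ _)
      (layerSum-indicator linked (∈-resp-↭ (↭-sym (Sort.sort-↭ cs)) (∈-tabulate⁺ {f = φ.coefficient} k)))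
    integral≤ : ∀ θ → 0# ≤ θ → θ < 1# → φ.integral ≤ layerSum 0# ds (λ d → ℙ (λ ω → θ * d < g ω))
    integral≤ θ 0≤θ θ<1 = begin
      ∑ (λ k → φ.coefficient k * ℙ (φ.set k))
        ≤⟨ ∑-mono-≤ (λ k → *-monoʳ-≤ (ℙ-nonNegative (φ.measurable k)) (coefficient≤ k)) ⟩
      ∑ (λ k → layerSum 0# ds (λ d → indicator d (φ.coefficient k)) * ℙ (φ.set k))
        ≈⟨ Sum.sum-cong-≋ (λ k → trans (*-comm _ _) (layerSum-* 0# ds (ℙ (φ.set k)) _)) ⟩
      ∑ (λ k → layerSum 0# ds (λ d → ℙ (φ.set k) * indicator d (φ.coefficient k)))
        ≈⟨ layerSum-∑ 0# ds (λ k d → ℙ (φ.set k) * indicator d (φ.coefficient k)) ⟩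
      layerSum 0# ds (λ d → ∑ (λ k → ℙ (φ.set k) * indicator d (φ.coefficient k)))
        ≤⟨ layerSum-mono-≤ ≤-refl linked (λ d 0<d →
             ∑-disjoint-≤ φ.set (λ k → indicator d (φ.coefficient k)) φ.measurable (mg _ (*-nonNegative 0≤θ (<⇒≤ 0<d)))
               φ.disjoint (included d 0<d)) ⟩
      layerSum 0# ds (λ d → ℙ (λ ω → θ * d < g ω)) ∎
      where
      θd<d : ∀ d → 0# < d → θ * d < d
      θd<d d 0<d = ≰⇒> λ d≤θd → <⇒≱ θ<1 (*-cancelˡ-≤ 0<d (≤-respˡ-≈ (sym (*-identityʳ d)) (≤-respʳ-≈ (*-comm θ d) d≤θd)))
      included : ∀ d → 0# < d → ∀ k → (indicator d (φ.coefficient k) ≈ 0#) ⊎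
                 ((indicator d (φ.coefficient k) ≈ 1#) × (φ.set k ⊆ (λ ω → θ * d < g ω)))
      included d 0<d k with indicator-view d (φ.coefficient k)
      ... | inj₁ i≈0         = inj₁ i≈0
      ... | inj₂ (i≈1 , d≤c) = inj₂ (i≈1 , λ a → <-≤-trans (θd<d d 0<d) (≤-trans d≤c (φ.below k a)))

  𝔼-upper : ∀ {f} → FiniteExpectation f → ∀ (φ : SimpleBelow f) → SimpleBelow.integral φ ≤ 𝔼 em f
  𝔼-upper {f} finite φ with em {FiniteExpectation f}
  ... | no infinite = contradiction finite infinite
  ... | yes bounded with complete (LowerIntegrals f) (lowerIntegrals-nonempty f) bounded
  ...   | e , lub = IsLub.upper lub (φ , refl)

  𝔼-least : ∀ {f b} → 0# ≤ b → (∀ (φ : SimpleBelow f) → SimpleBelow.integral φ ≤ b) → 𝔼 em f ≤ b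
  𝔼-least {f} {b} 0≤b bound with em {FiniteExpectation f}
  -- Without finite expectation `𝔼` has the default value zero.
  ... | no _ = 0≤b
  ... | yes bounded with complete (LowerIntegrals f) (lowerIntegrals-nonempty f) bounded
  ...   | e , lub = IsLub.least lub λ { (φ , integral≈) → ≤-respˡ-≈ integral≈ (bound φ) }

  𝔼-nonNegative : ∀ f → 0# ≤ 𝔼 em f
  𝔼-nonNegative f with em {FiniteExpectation f}
  ... | no _ = ≤-refl
  ... | yes bounded with complete (LowerIntegrals f) (lowerIntegrals-nonempty f) bounded
  ...   | e , lub = IsLub.upper lub (proj₂ (lowerIntegrals-nonempty f))

-- The threshold algorithm: its tail events as disjoint unions of boxes.

module Thresholds (R : RealField) where

  open OrderedField R
  open Regions R
  open import Data.Nat.Base using (zero; suc)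

  ⟦_⟧ : Region → Pred ℝ 0ℓ
  ⟦ atMost a ⟧   = _≤ a
  ⟦ above a ⟧    = a <_
  ⟦ everything ⟧ = U

  ⊔-< : ∀ {a b c} → a < c → b < c → a ⊔ b < c
  ⊔-< {a} {b} a<c b<c with ⊔-sel a b
  ... | inj₁ eq = <-respˡ-≈ (sym eq) a<c
  ... | inj₂ eq = <-respˡ-≈ (sym eq) b<c

  <?-cases : ∀ a b → (does (a <? b) ≡ true × a < b) ⊎ (does (a <? b) ≡ false × b ≤ a)
  <?-cases a b with a <? b
  ... | yes a<b = inj₁ (≡.refl , a<b)
  ... | no a≮b  = inj₂ (≡.refl , ≮⇒≥ a≮b)

  -- Where the value at time r has to lie for the value picked at time t to exceed x.
  region : ∀ {n} → Vector ℝ n → ℝ → Fin n → Fin n → Region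
  region τ x Fin.zero    Fin.zero    = above (head τ ⊔ x)
  region τ x Fin.zero    (Fin.suc r) = everything
  region τ x (Fin.suc t) Fin.zero    = atMost (head τ)
  region τ x (Fin.suc t) (Fin.suc r) = region (tail τ) x t r

  region-self : ∀ {n} (τ : Vector ℝ n) x t → region τ x t t ≡ above (τ t ⊔ x)
  region-self τ x Fin.zero    = ≡.refl
  region-self τ x (Fin.suc t) = region-self (tail τ) x t

  region-passive : ∀ {n} (τ : Vector ℝ n) x t r → (∀ i → 0# ≤ τ i) → r ≢ t → Passive (region τ x t r)
  region-passive τ x Fin.zero    Fin.zero    0≤τ r≢t = contradiction ≡.refl r≢t
  region-passive τ x Fin.zero    (Fin.suc r) 0≤τ r≢t = everything
  region-passive τ x (Fin.suc t) Fin.zero    0≤τ r≢t = atMost (0≤τ Fin.zero)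
  region-passive τ x (Fin.suc t) (Fin.suc r) 0≤τ r≢t = region-passive (tail τ) x t r (0≤τ ∘ Fin.suc) (r≢t ∘ ≡.cong Fin.suc)

  -- At the earlier of two distinct times, one event asks the value to exceed the threshold and the
  -- other asks it not to.
  region-disjoint : ∀ {n} (τ : Vector ℝ n) x t t′ (v : Vector ℝ n) → (∀ r → v r ∈ ⟦ region τ x t r ⟧) → (∀ r → v r ∈ ⟦ region τ x t′ r ⟧) → t ≡ t′
  region-disjoint τ x Fin.zero    Fin.zero     v p q = ≡.refl
  region-disjoint τ x Fin.zero    (Fin.suc t′) v p q =
    contradiction (≤-trans (q Fin.zero) (x≤x⊔y (head τ) x)) (<⇒≱ (p Fin.zero))
  region-disjoint τ x (Fin.suc t) Fin.zero     v p q =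
    contradiction (≤-trans (p Fin.zero) (x≤x⊔y (head τ) x)) (<⇒≱ (q Fin.zero))
  region-disjoint τ x (Fin.suc t) (Fin.suc t′) v p q =
    ≡.cong Fin.suc (region-disjoint (tail τ) x t t′ (tail v) (p ∘ Fin.suc) (q ∘ Fin.suc))

  -- The reward zero for picking nothing never exceeds a nonnegative `x`, so the algorithm does stop
  -- at some time.
  firstAbove⇒region : ∀ {n} (τ v : Vector ℝ n) {x} → 0# ≤ x → x < firstAbove τ v → ∃ λ t → ∀ r → v r ∈ ⟦ region τ x t r ⟧
  firstAbove⇒region {zero}  τ v 0≤x x<0 = contradiction 0≤x (<⇒≱ x<0)
  firstAbove⇒region {suc n} τ v 0≤x x< with <?-cases (head τ) (head v)
  ... | inj₁ (eq , τ<v) rewrite eq = Fin.zero , λ { Fin.zero → ⊔-< τ<v x< ; (Fin.suc r) → tt }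
  ... | inj₂ (eq , v≤τ) rewrite eq with firstAbove⇒region (tail τ) (tail v) 0≤x x<
  ...   | t , inside = Fin.suc t , λ { Fin.zero → v≤τ ; (Fin.suc r) → inside r }

  region⇒firstAbove : ∀ {n} (τ v : Vector ℝ n) {x} t → (∀ r → v r ∈ ⟦ region τ x t r ⟧) → x < firstAbove τ v
  region⇒firstAbove τ v {x} Fin.zero inside with <?-cases (head τ) (head v)
  ... | inj₁ (eq , τ<v) rewrite eq = ≤-<-trans (x≤y⊔x (head τ) x) (inside Fin.zero)
  ... | inj₂ (eq , v≤τ) = contradiction (≤-trans v≤τ (x≤x⊔y (head τ) x)) (<⇒≱ (inside Fin.zero))
  region⇒firstAbove τ v (Fin.suc t) inside with <?-cases (head τ) (head v)
  ... | inj₁ (eq , τ<v) = contradiction (inside Fin.zero) (<⇒≱ τ<v)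
  ... | inj₂ (eq , v≤τ) rewrite eq = region⇒firstAbove (tail τ) (tail v) t (inside ∘ Fin.suc)

  maximum-lub : ∀ {n} {v : Vector ℝ n} {x} → 0# ≤ x → (∀ i → v i ≤ x) → maximum v ≤ x
  maximum-lub {zero}  0≤x v≤x = 0≤x
  maximum-lub {suc n} 0≤x v≤x = ⊔-lub (v≤x Fin.zero) (maximum-lub 0≤x (v≤x ∘ Fin.suc))

  maximum-upper : ∀ {n} (v : Vector ℝ n) i → v i ≤ maximum v
  maximum-upper v Fin.zero    = x≤x⊔y _ _
  maximum-upper v (Fin.suc i) = ≤-trans (maximum-upper (tail v) i) (x≤y⊔x (head v) _)

  maximum-tail : ∀ {n} {A : Set} (Z : Vector (A → ℝ) n) {x} → 0# ≤ x →
                 (λ ω → x < maximum (λ i → Z i ω)) ≐ ∁ (λ ω → ∀ i → Z i ω ≤ x)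
  maximum-tail Z 0≤x =
    (λ x<max v≤x → <⇒≱ x<max (maximum-lub 0≤x v≤x)) ,
    λ {ω} ¬all → ≰⇒> λ max≤x → ¬all λ i → ≤-trans (maximum-upper (λ j → Z j ω) i) max≤x

  module _ {n} (τ : Vector ℝ n) (σ : Permutation′ n) where

    -- Moves the conditions from times to positions of the instance, to which the distributions
    -- belong: position `i` is shown at time `σ ⟨$⟩ˡ i`.
    slotRegion : ℝ → Fin n → Fin n → Region
    slotRegion x t i = region τ x t (σ ⟨$⟩ˡ i)

    private
      to-time : ∀ (z : Vector ℝ n) x t → (∀ i → z i ∈ ⟦ slotRegion x t i ⟧) → ∀ r → z (σ ⟨$⟩ʳ r) ∈ ⟦ region τ x t r ⟧
      to-time z x t inside r = ≡.subst (λ r′ → z (σ ⟨$⟩ʳ r) ∈ ⟦ region τ x t r′ ⟧) (Perm.inverseˡ σ) (inside (σ ⟨$⟩ʳ r))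

      to-slot : ∀ (z : Vector ℝ n) x t → (∀ r → z (σ ⟨$⟩ʳ r) ∈ ⟦ region τ x t r ⟧) → ∀ i → z i ∈ ⟦ slotRegion x t i ⟧
      to-slot z x t inside i = ≡.subst (λ j → z j ∈ ⟦ slotRegion x t i ⟧) (Perm.inverseʳ σ) (inside (σ ⟨$⟩ˡ i))

    reward-tail : ∀ {A : Set} (Z : Vector (A → ℝ) n) {x} → 0# ≤ x →
                  (λ ω → x < reward τ σ (λ i → Z i ω)) ≐ (λ ω → ∃ λ t → ∀ i → Z i ω ∈ ⟦ slotRegion x t i ⟧)
    reward-tail Z {x} 0≤x =
      (λ {ω} x< → let t , inside = firstAbove⇒region τ _ 0≤x x< in t , to-slot (λ i → Z i ω) x t inside) ,
      λ { {ω} (t , inside) → region⇒firstAbove τ _ t (to-time (λ i → Z i ω) x t inside) }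

    slotRegion-disjoint : ∀ x t t′ (z : Vector ℝ n) → (∀ i → z i ∈ ⟦ slotRegion x t i ⟧) → (∀ i → z i ∈ ⟦ slotRegion x t′ i ⟧) → t ≡ t′
    slotRegion-disjoint x t t′ z p q = region-disjoint τ x t t′ (z ∘ (σ ⟨$⟩ʳ_)) (to-time z x t p) (to-time z x t′ q)

    slotRegion-self : ∀ x t → slotRegion x t (σ ⟨$⟩ʳ t) ≡ above (τ t ⊔ x)
    slotRegion-self x t = ≡.trans (≡.cong (region τ x t) (Perm.inverseˡ σ)) (region-self τ x t)

    slotRegion-passive : ∀ x t i → (∀ r → 0# ≤ τ r) → i ≢ σ ⟨$⟩ʳ t → Passive (slotRegion x t i)
    slotRegion-passive x t i 0≤τ i≢σt = region-passive τ x t _ 0≤τ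
      (λ σ⁻¹i≡t → i≢σt (≡.trans (≡.sym (Perm.inverseʳ σ)) (≡.cong (σ ⟨$⟩ʳ_) σ⁻¹i≡t)))

    reward<⇒maximum< : ∀ (z : Vector ℝ n) {x} → 0# ≤ x → x < reward τ σ z → x < maximum z
    reward<⇒maximum< z {x} 0≤x x< =
      let t , inside = firstAbove⇒region τ _ 0≤x x<
      in <-≤-trans (≤-<-trans (x≤y⊔x (τ t) x) (≡.subst (λ V → z (σ ⟨$⟩ʳ t) ∈ ⟦ V ⟧) (region-self τ x t) (inside t)))
                   (maximum-upper z (σ ⟨$⟩ʳ t))

-- Probabilities of boxes under independent and reordered draws.

module Draws (em : ExcludedMiddle (Level.suc 0ℓ)) (R : RealField) (P : Real.ProbabilitySpace R) where

  open OrderedField R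
  open SumsAndProducts R
  open Regions R
  open Thresholds R
  open Probability P
  open Measure em R P
  open Solver using (solve; _:=_; _:+_; _:*_; _:-_)
  open import Data.Nat.Base using (zero; suc)
  open ≤-Reasoning

  above-≐ : ∀ {A : Set} (f : A → ℝ) a → ∁ (λ ω → f ω ≤ a) ≐ (λ ω → a < f ω)
  above-≐ f a = ≰⇒> , <⇒≱

  borel : ∀ V → Borel ⟦ V ⟧
  borel (atMost a)   = half-line a
  borel (above a)    = respects (above-≐ (λ x → x) a) (complement (half-line a))
  -- The whole line is a half-line together with its complement.
  borel everything   = respects ((λ _ → tt) , λ {y} _ → cover y) (union {B = halves} borel-halves)
    where
    halves : ℕ → Pred ℝ 0ℓ
    halves zero    = _≤ 0#
    halves (suc _) = ∁ (_≤ 0#)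
    borel-halves : ∀ k → Borel (halves k)
    borel-halves zero    = half-line 0#
    borel-halves (suc _) = complement (half-line 0#)
    cover : ∀ y → ⋃ ℕ halves y
    cover y with y ≤? 0#
    ... | yes y≤0 = 0 , y≤0
    ... | no y≰0  = 1 , y≰0

  -- Shared by `ℙ` and the conditional probabilities given a value of `ρ`, so that one computation
  -- of box probabilities covers both.
  record Normalised (Q : Pred Ω 0ℓ → ℝ) : Set (Level.suc 0ℓ) where
    field
      cong       : ∀ {A B} → Measurable A → A ≐ B → Q A ≈ Q B
      ofComplement : ∀ {A} → Measurable A → Q (∁ A) ≈ 1# - Q A
      universe   : Q U ≈ 1#

  ℙ-complement : ∀ {A C} → Measurable A → Measurable C → ℙ (∁ A ∩ C) ≈ ℙ C - ℙ (A ∩ C)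
  ℙ-complement {A} {C} mA mC = begin-equality
    ℙ (∁ A ∩ C)                          ≈⟨ ℙ-cong (measurable-∩ (m-complement mA) mC) ((λ { (a , c) → c , a }) , λ { (c , a) → a , c }) ⟩
    ℙ (C ∩ ∁ A)                          ≈⟨ solve 2 (λ x y → y := (x :+ y) :- x) refl (ℙ (C ∩ A)) _ ⟩
    (ℙ (C ∩ A) + ℙ (C ∩ ∁ A)) - ℙ (C ∩ A)  ≈⟨ +-cong (sym (ℙ-split mC mA)) (-‿cong (ℙ-cong (measurable-∩ mC mA) ((λ { (a , c) → c , a }) , λ { (c , a) → a , c }))) ⟩
    ℙ C - ℙ (A ∩ C)                      ∎

  normalised-ℙ : Normalised ℙ
  normalised-ℙ = record
    { cong = ℙ-cong
    ; ofComplement = λ {A} mA → begin-equality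
        ℙ (∁ A)              ≈⟨ ℙ-cong (m-complement mA) ((λ a → a , tt) , proj₁) ⟩
        ℙ (∁ A ∩ U)          ≈⟨ ℙ-complement mA m-universe ⟩
        ℙ U - ℙ (A ∩ U)      ≈⟨ +-cong ℙ-universe (-‿cong (ℙ-cong (measurable-∩ mA m-universe) (proj₁ , λ a → a , tt))) ⟩
        1# - ℙ A             ∎
    ; universe = ℙ-universe }

  normalised-conditional : ∀ {C} → Measurable C → 0# < ℙ C → Normalised (λ A → ℙ[ A ∣ C ])
  normalised-conditional {C} mC 0<ℙC = record
    { cong = λ mA A≐B → *-congʳ (ℙ-cong (measurable-∩ mA mC)
        ((λ { (a , c) → proj₁ A≐B a , c }) , λ { (b , c) → proj₂ A≐B b , c }))
    ; ofComplement = λ {A} mA → begin-equality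
        ℙ (∁ A ∩ C) * ℙ C ⁻¹                      ≈⟨ *-congʳ (ℙ-complement mA mC) ⟩
        (ℙ C - ℙ (A ∩ C)) * ℙ C ⁻¹                ≈⟨ solve 3 (λ c x w → (c :- x) :* w := c :* w :- x :* w) refl (ℙ C) (ℙ (A ∩ C)) (ℙ C ⁻¹) ⟩
        ℙ C * ℙ C ⁻¹ - ℙ (A ∩ C) * ℙ C ⁻¹         ≈⟨ +-congʳ inverse ⟩
        1# - ℙ (A ∩ C) * ℙ C ⁻¹                   ∎
    ; universe = trans (*-congʳ (ℙ-cong (measurable-∩ m-universe mC) (proj₂ , λ c → tt , c))) inverse }
    where
    inverse : ℙ C * ℙ C ⁻¹ ≈ 1#
    inverse = ⁻¹-inverse (<⇒≉0 0<ℙC)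

  MeasurableFamily : ∀ {n} → Vector (Ω → ℝ) n → Set (Level.suc 0ℓ)
  MeasurableFamily Z = ∀ i {B} → Borel B → Measurable (λ ω → Z i ω ∈ B)

  measurable-box : ∀ {n} {Z : Vector (Ω → ℝ) n} → MeasurableFamily Z → ∀ (V : Vector Region n) → Measurable (λ ω → ∀ i → Z i ω ∈ ⟦ V i ⟧)
  measurable-box mZ V = measurable-∀ λ i → mZ i (borel (V i))

  draw-box : ∀ {n Q} {J : Instance n} {Z} → Normalised Q → IsDraw Q J Z → ∀ (V : Vector Region n) →
             Q (λ ω → ∀ i → Z i ω ∈ ⟦ V i ⟧) ≈ ∏ (λ i → mass (V i) (J i))
  draw-box {Q = Q} {J} {Z} normalised draw V =
    trans (draw.independent (λ i → ⟦ V i ⟧) (borel ∘ V)) (Prod.sum-cong-≋ λ i → marginal i (V i))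
    where
    module draw = IsDraw draw
    open Normalised normalised
    marginal : ∀ i V → Q (λ ω → Z i ω ∈ ⟦ V ⟧) ≈ mass V (J i)
    marginal i (atMost a)  = draw.law i a
    marginal i everything  = universe
    marginal i (above a)   = begin-equality
      Q (λ ω → a < Z i ω)         ≈⟨ cong (m-complement (draw.measurable i (half-line a))) (above-≐ (Z i) a) ⟨
      Q (∁ (λ ω → Z i ω ≤ a))     ≈⟨ ofComplement (draw.measurable i (half-line a)) ⟩
      1# - Q (λ ω → Z i ω ≤ a)    ≈⟨ +-congˡ (-‿cong (draw.law i a)) ⟩
      1# - J i a                  ∎

  module _ {n} {Z : Vector (Ω → ℝ) n} (mZ : MeasurableFamily Z) where

    maximum-measurable : MeasurableTails (λ ω → maximum (λ i → Z i ω))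
    maximum-measurable x 0≤x = m-resp (≐-sym (maximum-tail Z 0≤x)) (m-complement (measurable-box mZ (const (atMost x))))

    ℙ-maximum-tail : ∀ x → 0# ≤ x → ℙ (λ ω → x < maximum (λ i → Z i ω)) ≈ 1# - ℙ (λ ω → ∀ i → Z i ω ≤ x)
    ℙ-maximum-tail x 0≤x = trans (ℙ-cong (maximum-measurable x 0≤x) (maximum-tail Z 0≤x))
      (Normalised.ofComplement normalised-ℙ (measurable-box mZ (const (atMost x))))

    module _ (τ : Vector ℝ n) (σ : Permutation′ n) where

      slot : ℝ → Fin n → Pred Ω 0ℓ
      slot x t ω = ∀ i → Z i ω ∈ ⟦ slotRegion τ σ x t i ⟧

      measurable-slot : ∀ x t → Measurable (slot x t)
      measurable-slot x t = measurable-box mZ (slotRegion τ σ x t)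

      reward-measurable : MeasurableTails (λ ω → reward τ σ (λ i → Z i ω))
      reward-measurable x 0≤x = m-resp (≐-sym (reward-tail τ σ Z 0≤x)) (measurable-∃ (measurable-slot x))

      ℙ-reward-tail : ∀ x → 0# ≤ x → ℙ (λ ω → x < reward τ σ (λ i → Z i ω)) ≈ ∑ (λ t → ℙ (slot x t))
      ℙ-reward-tail x 0≤x = trans (ℙ-cong (reward-measurable x 0≤x) (reward-tail τ σ Z 0≤x))
        (ℙ-∃ (measurable-slot x) λ t t′ t≢t′ → λ { {ω} (p , q) → t≢t′ (slotRegion-disjoint τ σ x t t′ (λ i → Z i ω) p q) })

      reward-tail-≤-maximum-tail : ∀ x → 0# ≤ x → ℙ (λ ω → x < reward τ σ (λ i → Z i ω)) ≤ ℙ (λ ω → x < maximum (λ i → Z i ω))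
      reward-tail-≤-maximum-tail x 0≤x =
        ℙ-mono (reward-measurable x 0≤x) (maximum-measurable x 0≤x) (reward<⇒maximum< τ σ _ 0≤x)

  module Reordering {n} (I : Instance n) (s : ℕ) (ρ : Ω → Permutation′ n) (Z : Vector (Ω → ℝ) n)
           (uniform : IsUniformOnFirst s ρ) (draws : IsReorderedDraw I ρ Z) where

    module uniform = IsUniformOnFirst uniform

    N! : ℝ
    N! = fromℕ (s !)

    0<N! : 0# < N!
    0<N! with s ! | ℕ.1≤n! s
    ... | suc k | _ = fromℕ-positive k

    0<N!⁻¹ : 0# < N! ⁻¹
    0<N!⁻¹ = ⁻¹-positive 0<N!

    positive : ∀ π → FixesFrom s π → 0# < ℙ [ ρ ≔ π ]
    positive π fixes = <-respʳ-≈ (sym (uniform.uniform π fixes)) 0<N!⁻¹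

    -- `IsReorderedDraw` speaks only about permutations of positive probability; the identity is one
    -- of them.
    measurable-draw : MeasurableFamily Z
    measurable-draw = IsDraw.measurable (draws Perm.id (positive Perm.id λ _ _ → ≡.refl))

    -- The law of total probability over the values of `ρ`. The listing is a parameter because a
    -- shuffled stopping slot calls for the listing with that slot as pivot.
    average-box : (π : Vector (Permutation′ n) (s !)) → (∀ k → FixesFrom s (π k)) → (∀ j k → π j Perm.≈ π k → j ≡ k) →
      (∀ π′ → FixesFrom s π′ → ∃ λ k → π′ Perm.≈ π k) →
      ∀ (V : Vector Region n) → ℙ (λ ω → ∀ i → Z i ω ∈ ⟦ V i ⟧) ≈ ∑ (λ k → ∏ (λ i → mass (V i) (I (π k ⟨$⟩ʳ i)))) * N! ⁻¹
    average-box π fixes distinct complete V = begin-equality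
      ℙ A                                              ≈⟨ ℙ-cong mA ((λ {ω} a → let k , eq = complete (ρ ω) (uniform.fixes-rest ω) in k , a , eq) , λ { (k , a , _) → a }) ⟩
      ℙ (λ ω → ∃ λ k → (A ∩ [ ρ ≔ π k ]) ω)            ≈⟨ ℙ-∃ (λ k → measurable-∩ mA (uniform.measurable (π k)))
                                                           (λ j k j≢k → λ { ((_ , p) , (_ , q)) → j≢k (distinct j k λ i → ≡.trans (≡.sym (p i)) (q i)) }) ⟩
      ∑ (λ k → ℙ (A ∩ [ ρ ≔ π k ]))                    ≈⟨ Sum.sum-cong-≋ piece ⟩
      ∑ (λ k → ∏ (λ i → mass (V i) (I (π k ⟨$⟩ʳ i))) * N! ⁻¹) ≈⟨ Sum.*-distribʳ-sum (N! ⁻¹) (λ k → ∏ (λ i → mass (V i) (I (π k ⟨$⟩ʳ i)))) ⟨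
      ∑ (λ k → ∏ (λ i → mass (V i) (I (π k ⟨$⟩ʳ i)))) * N! ⁻¹ ∎
      where
      A : Pred Ω 0ℓ
      A ω = ∀ i → Z i ω ∈ ⟦ V i ⟧
      mA = measurable-box measurable-draw V
      piece : ∀ k → ℙ (A ∩ [ ρ ≔ π k ]) ≈ ∏ (λ i → mass (V i) (I (π k ⟨$⟩ʳ i))) * N! ⁻¹
      piece k = begin-equality
        ℙ (A ∩ C)                                ≈⟨ *-identityʳ _ ⟨
        ℙ (A ∩ C) * 1#                           ≈⟨ *-congˡ (⁻¹-inverse (<⇒≉0 0<ℙC)) ⟨
        ℙ (A ∩ C) * (ℙ C * ℙ C ⁻¹)               ≈⟨ solve 3 (λ x c w → x :* (c :* w) := (x :* w) :* c) refl (ℙ (A ∩ C)) (ℙ C) (ℙ C ⁻¹) ⟩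
        ℙ[ A ∣ C ] * ℙ C                         ≈⟨ *-cong (draw-box (normalised-conditional (uniform.measurable (π k)) 0<ℙC) (draws (π k) 0<ℙC) V)
                                                      (uniform.uniform (π k) (fixes k)) ⟩
        ∏ (λ i → mass (V i) (I (π k ⟨$⟩ʳ i))) * N! ⁻¹ ∎
        where
        C = [ ρ ≔ π k ]
        0<ℙC = positive (π k) (fixes k)

-- Comparison of the expected rewards.

module Comparison (em : ExcludedMiddle (Level.suc 0ℓ)) (R : RealField) (P : Real.ProbabilitySpace R) where

  open OrderedField R
  open SumsAndProducts R
  open Regions R
  open Thresholds R
  open SlotBound R
  open Probability P
  open Measure em R P
  open Draws em R P
  open PermutationsFixingFrom using (perms; permsAt; perms-fix; permsAt-fix; perms-distinct; permsAt-distinct; perms-complete; permsAt-complete)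
  open Solver using (solve; _:=_; _:+_; _:*_; _:-_; :1)
  open ≤-Reasoning

  cdf-proper : ∀ {F} → IsCDF F → Proper F
  cdf-proper {F} cdf x = nonNegative , cdf.at-most-one x
    where
    module cdf = IsCDF cdf
    -1<0 : - 1# < 0#
    -1<0 = <-respˡ-≈ (+-identityˡ _) (<-respʳ-≈ (x-x 1#) (+-monoˡ-< (- 1#) 0<1))
    nonNegative : 0# ≤ F x
    nonNegative with x <? 0#
    ... | yes x<0 = ≤-reflexive (sym (cdf.zero-on-negative x<0))
    ... | no x≮0  = ≤-respˡ-≈ (cdf.zero-on-negative -1<0) (cdf.monotone (≤-trans (<⇒≤ -1<0) (≮⇒≥ x≮0)))

  -- Division by `q` makes `q ⁻¹ * 𝔼 em f` an upper bound for every simple function below `g`.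
  -- Finiteness for `f` ensures that `𝔼 em f` is the supremum and not the default zero.
  𝔼-tail-comparison : ∀ {f g} q → MeasurableTails f → MeasurableTails g → 0# < q → FiniteExpectation f →
    (∀ x → 0# ≤ x → q * ℙ (λ ω → x < g ω) ≤ ℙ (λ ω → x < f ω)) → q * 𝔼 em g ≤ 𝔼 em f
  𝔼-tail-comparison {f} {g} q mf mg 0<q finite tails = begin
    q * 𝔼 em g               ≤⟨ *-monoˡ-≤ (<⇒≤ 0<q) (𝔼-least 0≤b bound) ⟩
    q * (q ⁻¹ * 𝔼 em f)      ≈⟨ cancel (𝔼 em f) ⟩
    𝔼 em f                   ∎
    where
    cancel : ∀ y → q * (q ⁻¹ * y) ≈ y
    cancel y = trans (sym (*-assoc _ _ _)) (trans (*-congʳ (⁻¹-inverse (<⇒≉0 0<q))) (*-identityˡ y))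
    0≤b : 0# ≤ q ⁻¹ * 𝔼 em f
    0≤b = *-nonNegative (<⇒≤ (⁻¹-positive 0<q)) (𝔼-nonNegative f)
    bound : ∀ (φ : SimpleBelow g) → SimpleBelow.integral φ ≤ q ⁻¹ * 𝔼 em f
    bound φ = *-cancelˡ-≤ 0<q (≤-respʳ-≈ (sym (cancel (𝔼 em f)))
      (tail-comparison q (𝔼 em f) mf mg (<⇒≤ 0<q) tails (𝔼-upper finite) φ))

  module _ {m} (I : Instance (ℕ.suc m)) (cdfs : IsInstance I) (s : ℕ) (s≤m : ℕ.suc s ℕ.≤ ℕ.suc m)
           (G : ℝ → ℝ) (root : ∀ x → IsRoot (ℕ.suc s) (productFirst (ℕ.suc s) s≤m I x) (G x))
           (ε : ℝ) (small : ∀ i → toℕ i ℕ.< ℕ.suc s → Small ε (I i))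
           (τ : Vector ℝ (ℕ.suc m)) (0≤τ : ∀ t → 0# ≤ τ t) (σ : Permutation′ (ℕ.suc m))
           (X Y Z : Vector (Ω → ℝ) (ℕ.suc m)) (ρ : Ω → Permutation′ (ℕ.suc m))
           (drawX : IsDraw ℙ I X) (drawY : IsDraw ℙ (replaceFirst (ℕ.suc s) G I) Y)
           (uniform : IsUniformOnFirst (ℕ.suc s) ρ) (drawZ : IsReorderedDraw I ρ Z)
           (finite : FiniteExpectation (λ ω → maximum (λ i → X i ω))) where

    open Reordering I (ℕ.suc s) ρ Z uniform drawZ

    private
      n = ℕ.suc m
      N = ℕ.suc s !
      I′ = replaceFirst (ℕ.suc s) G I
      maxX rewardY rewardZ : Ω → ℝ
      maxX ω    = maximum (λ i → X i ω)
      rewardY ω = reward τ σ (λ i → Y i ω)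
      rewardZ ω = reward τ σ (λ i → Z i ω)

      proper : ∀ i → Proper (I i)
      proper i = cdf-proper (cdfs i)
      mX = IsDraw.measurable drawX
      mY = IsDraw.measurable drawY
      mZ = measurable-draw

      average-perms : ∀ V → ℙ (λ ω → ∀ i → Z i ω ∈ ⟦ V i ⟧) ≈ ∑ (λ k → ∏ (λ i → mass (V i) (I (perms (ℕ.suc s) s≤m k ⟨$⟩ʳ i)))) * N! ⁻¹
      average-perms = average-box (perms (ℕ.suc s) s≤m) (perms-fix (ℕ.suc s) s≤m) (perms-distinct (ℕ.suc s) s≤m) (perms-complete (ℕ.suc s) s≤m)

      average-permsAt : ∀ c → toℕ c ℕ.≤ s → ∀ V →
        ℙ (λ ω → ∀ i → Z i ω ∈ ⟦ V i ⟧) ≈ ∑ (λ k → ∏ (λ i → mass (V i) (I (permsAt s s≤m c k ⟨$⟩ʳ i)))) * N! ⁻¹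
      average-permsAt c c≤s = average-box (permsAt s s≤m c) (permsAt-fix s s≤m c c≤s) (permsAt-distinct s s≤m c) (permsAt-complete s s≤m c c≤s)

    -- `G x ^ suc s` is the product of the first distributions at `x`, so their replacement by `G`
    -- preserves the law of the maximum.
    box-Y : ∀ x → ℙ (λ ω → ∀ i → Y i ω ≤ x) ≈ ∏ (λ i → I i x)
    box-Y x = begin-equality
      ℙ (λ ω → ∀ i → Y i ω ≤ x)      ≈⟨ draw-box normalised-ℙ drawY (const (atMost x)) ⟩
      ∏ (λ i → I′ i x)               ≈⟨ ∏-first (ℕ.suc s) s≤m (λ i → I′ i x) ⟩
      ∏ {ℕ.suc s} (λ i → I′ (inject≤ i s≤m) x) * ∏ (λ i → if does (toℕ i ℕ.<? ℕ.suc s) then 1# else I′ i x)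
        ≈⟨ *-cong inner (Prod.sum-cong-≋ outer) ⟩
      ∏ {ℕ.suc s} (λ i → I (inject≤ i s≤m) x) * ∏ (λ i → if does (toℕ i ℕ.<? ℕ.suc s) then 1# else I i x)
        ≈⟨ ∏-first (ℕ.suc s) s≤m (λ i → I i x) ⟨
      ∏ (λ i → I i x)                ∎
      where
      inner : ∏ {ℕ.suc s} (λ i → I′ (inject≤ i s≤m) x) ≈ ∏ {ℕ.suc s} (λ i → I (inject≤ i s≤m) x)
      inner = begin-equality
        ∏ {ℕ.suc s} (λ i → I′ (inject≤ i s≤m) x)   ≈⟨ Prod.sum-cong-≋ {ℕ.suc s} (λ i → reflexive (≡.cong (_$ x)
              (replaceFirst-< (ℕ.suc s) G I (inject≤ i s≤m) (≡.subst (ℕ._< ℕ.suc s) (≡.sym (Fin.toℕ-inject≤ i s≤m)) (Fin.toℕ<n i))))) ⟩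
        ∏ {ℕ.suc s} (const (G x))                  ≈⟨ ∏-const (ℕ.suc s) (G x) ⟩
        G x ^ ℕ.suc s                              ≈⟨ IsRoot.power (root x) ⟩
        ∏ {ℕ.suc s} (λ i → I (inject≤ i s≤m) x)    ∎
      outer : ∀ i → (if does (toℕ i ℕ.<? ℕ.suc s) then 1# else I′ i x) ≈ (if does (toℕ i ℕ.<? ℕ.suc s) then 1# else I i x)
      outer i with <?-view (toℕ i) (ℕ.suc s)
      ... | inj₁ (_ , eq) rewrite eq = refl
      ... | inj₂ (_ , eq) rewrite eq = refl

    -- Each value of `ρ` merely permutes the factors, so all terms of the average coincide.
    box-Z : ∀ x → ℙ (λ ω → ∀ i → Z i ω ≤ x) ≈ ∏ (λ i → I i x)
    box-Z x = begin-equality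
      ℙ (λ ω → ∀ i → Z i ω ≤ x)
        ≈⟨ average-perms (const (atMost x)) ⟩
      ∑ {N} (λ k → ∏ (λ i → I (perms (ℕ.suc s) s≤m k ⟨$⟩ʳ i) x)) * N! ⁻¹
        ≈⟨ *-congʳ (Sum.sum-cong-≋ {N} λ k → sym (Prod.sum-permute (λ i → I i x) (perms (ℕ.suc s) s≤m k))) ⟩
      ∑ {N} (const (∏ (λ i → I i x))) * N! ⁻¹
        ≈⟨ *-congʳ (∑-const N _) ⟩
      N! * ∏ (λ i → I i x) * N! ⁻¹
        ≈⟨ solve 3 (λ a p w → a :* p :* w := (a :* w) :* p) refl N! (∏ (λ i → I i x)) (N! ⁻¹) ⟩
      (N! * N! ⁻¹) * ∏ (λ i → I i x)
        ≈⟨ *-congʳ (⁻¹-inverse (<⇒≉0 0<N!)) ⟩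
      1# * ∏ (λ i → I i x)
        ≈⟨ *-identityˡ _ ⟩
      ∏ (λ i → I i x) ∎

    maximum-tail-≈ : ∀ {W : Vector (Ω → ℝ) n} → MeasurableFamily W → (∀ x → ℙ (λ ω → ∀ i → W i ω ≤ x) ≈ ∏ (λ i → I i x)) →
      ∀ x → 0# ≤ x → ℙ (λ ω → x < maximum (λ i → W i ω)) ≈ ℙ (λ ω → x < maxX ω)
    maximum-tail-≈ {W} mW box x 0≤x = begin-equality
      ℙ (λ ω → x < maximum (λ i → W i ω))      ≈⟨ ℙ-maximum-tail mW x 0≤x ⟩
      1# - ℙ (λ ω → ∀ i → W i ω ≤ x)           ≈⟨ +-congˡ (-‿cong (trans (box x) (sym (draw-box normalised-ℙ drawX (const (atMost x)))))) ⟩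
      1# - ℙ (λ ω → ∀ i → X i ω ≤ x)           ≈⟨ ℙ-maximum-tail mX x 0≤x ⟨
      ℙ (λ ω → x < maxX ω)                     ∎

    -- The factor `1#` gives it the shape of a tail comparison with `q = 1#`.
    reward-tail-≤ : ∀ {W : Vector (Ω → ℝ) n} → MeasurableFamily W → (∀ x → ℙ (λ ω → ∀ i → W i ω ≤ x) ≈ ∏ (λ i → I i x)) →
      ∀ x → 0# ≤ x → 1# * ℙ (λ ω → x < reward τ σ (λ i → W i ω)) ≤ ℙ (λ ω → x < maxX ω)
    reward-tail-≤ {W} mW box x 0≤x = begin
      1# * ℙ (λ ω → x < reward τ σ (λ i → W i ω))   ≈⟨ *-identityˡ _ ⟩
      ℙ (λ ω → x < reward τ σ (λ i → W i ω))        ≤⟨ reward-tail-≤-maximum-tail mW τ σ x 0≤x ⟩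
      ℙ (λ ω → x < maximum (λ i → W i ω))           ≈⟨ maximum-tail-≈ mW box x 0≤x ⟩
      ℙ (λ ω → x < maxX ω)                          ∎

    𝔼rewardY≤𝔼max : 𝔼 em rewardY ≤ 𝔼 em maxX
    𝔼rewardY≤𝔼max = ≤-respˡ-≈ (*-identityˡ _)
      (𝔼-tail-comparison 1# (maximum-measurable mX) (reward-measurable mY τ σ) 0<1 finite (reward-tail-≤ mY box-Y))

    -- Keeps `𝔼 em rewardZ` from being the default zero, against which no lower bound could be
    -- proved.
    finite-rewardZ : FiniteExpectation rewardZ
    finite-rewardZ = 𝔼 em maxX , λ { (φ , integral≈) → ≤-respˡ-≈ (trans (*-identityˡ _) integral≈)
      (tail-comparison 1# (𝔼 em maxX) (maximum-measurable mX) (reward-measurable mZ τ σ) 0≤1 (reward-tail-≤ mZ box-Z) (𝔼-upper finite) φ) }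

    module _ (q : ℝ) (0≤q : 0# ≤ q) (q≤1 : q ≤ 1#) (q+ε≈1 : q ≈ 1# - ε) where

      q≤I : ∀ i → toℕ i ℕ.< ℕ.suc s → ∀ x → 0# ≤ x → q ≤ I i x
      q≤I i i<s x 0≤x = begin
        q                        ≈⟨ q+ε≈1 ⟩
        1# - ε                   ≤⟨ sub-mono-≤ ≤-refl (small i i<s) ⟩
        1# - (1# - I i 0#)       ≈⟨ solve 1 (λ y → :1 :- (:1 :- y) := y) refl (I i 0#) ⟩
        I i 0#                   ≤⟨ IsCDF.monotone (cdfs i) 0≤x ⟩
        I i x                    ∎

      slot-≤ : ∀ x t → 0# ≤ x → q * q * ℙ (slot mY τ σ x t) ≤ ℙ (slot mZ τ σ x t)
      slot-≤ x t 0≤x = begin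
        q * q * ℙ (slot mY τ σ x t)                     ≈⟨ *-congˡ (draw-box normalised-ℙ drawY V) ⟩
        q * q * W                                       ≈⟨ *-identityˡ _ ⟨
        1# * (q * q * W)                                ≈⟨ *-congʳ (⁻¹-inverse (<⇒≉0 0<N!)) ⟨
        (N! * N! ⁻¹) * (q * q * W)                      ≈⟨ solve 3 (λ a w y → (a :* w) :* y := (a :* y) :* w) refl N! (N! ⁻¹) (q * q * W) ⟩
        (N! * (q * q * W)) * N! ⁻¹                      ≤⟨ bound ⟩
        ℙ (slot mZ τ σ x t)                             ∎
        where
        V = slotRegion τ σ x t
        c = σ ⟨$⟩ʳ t
        W = ∏ (λ i → mass (V i) (I′ i))
        0≤a : 0# ≤ τ t ⊔ x
        0≤a = ≤-trans 0≤x (x≤y⊔x (τ t) x)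
        passive : ∀ r → Passive (V (punchIn c r))
        passive r = slotRegion-passive τ σ x t (punchIn c r) 0≤τ (Fin.punchInᵢ≢i c r)
        bound : (N! * (q * q * W)) * N! ⁻¹ ≤ ℙ (slot mZ τ σ x t)
        bound with toℕ c ℕ.≤? s
        ... | yes c≤s = ≤-trans (*-monoʳ-≤ (<⇒≤ 0<N!⁻¹)
              (slot-bound-inner I s s≤m G q proper root 0≤q q≤1 q≤I V c (τ t ⊔ x) 0≤a (slotRegion-self τ σ x t) passive c≤s))
            (≤-reflexive (sym (average-permsAt c c≤s V)))
        ... | no c≰s = ≤-trans (*-monoʳ-≤ (<⇒≤ 0<N!⁻¹)
              (slot-bound-outer I s s≤m G q proper root 0≤q q≤1 q≤I V c (τ t ⊔ x) 0≤a (slotRegion-self τ σ x t) passive (ℕ.≰⇒> c≰s)))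
            (≤-reflexive (sym (average-perms V)))

      reward-tail-comparison : ∀ x → 0# ≤ x → q * q * ℙ (λ ω → x < rewardY ω) ≤ ℙ (λ ω → x < rewardZ ω)
      reward-tail-comparison x 0≤x = begin
        q * q * ℙ (λ ω → x < rewardY ω)                 ≈⟨ *-congˡ (ℙ-reward-tail mY τ σ x 0≤x) ⟩
        q * q * ∑ (λ t → ℙ (slot mY τ σ x t))           ≈⟨ Sum.*-distribˡ-sum (q * q) (λ t → ℙ (slot mY τ σ x t)) ⟩
        ∑ (λ t → q * q * ℙ (slot mY τ σ x t))           ≤⟨ ∑-mono-≤ (λ t → slot-≤ x t 0≤x) ⟩
        ∑ (λ t → ℙ (slot mZ τ σ x t))                   ≈⟨ ℙ-reward-tail mZ τ σ x 0≤x ⟨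
        ℙ (λ ω → x < rewardZ ω)                         ∎

    -- At least one distribution is small, and its probability of being positive is nonnegative.
    0≤ε : 0# ≤ ε
    0≤ε = ≤-trans (0≤y-x (proj₂ (proper Fin.zero 0#))) (small Fin.zero (ℕ.s≤s ℕ.z≤n))

    reward-comparison : 𝔼 em rewardY - (1# + 1#) * ε * 𝔼 em maxX ≤ 𝔼 em rewardZ
    reward-comparison with 1# ≤? ε
    -- Here `1# - ε` is not positive and the tail comparison is of no use, but the subtracted term
    -- already exceeds `𝔼 em maxX`, hence `𝔼 em rewardY`.
    ... | yes 1≤ε = 0≤y-x⇒x≤y (≤-respʳ-≈
      (solve 4 (λ z y e M → z :+ ((M :- y) :+ ((e :- :1) :* M :+ e :* M)) := z :- (y :- (:1 :+ :1) :* e :* M)) refl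
        (𝔼 em rewardZ) (𝔼 em rewardY) ε (𝔼 em maxX))
      (+-nonNegative (𝔼-nonNegative rewardZ) (+-nonNegative (0≤y-x 𝔼rewardY≤𝔼max)
        (+-nonNegative (*-nonNegative (0≤y-x 1≤ε) (𝔼-nonNegative maxX)) (*-nonNegative 0≤ε (𝔼-nonNegative maxX))))))
    -- The gap is the one of the tail comparison plus `ε² y + 2 ε (M - y)`, with `y` and `M` the
    -- expectations of `rewardY` and `maxX`.
    ... | no 1≰ε = 0≤y-x⇒x≤y (≤-respʳ-≈
      (solve 4 (λ z y e M → (z :- (:1 :- e) :* (:1 :- e) :* y) :+ (e :* e :* y :+ (:1 :+ :1) :* (e :* (M :- y)))
                            := z :- (y :- (:1 :+ :1) :* e :* M)) refl
        (𝔼 em rewardZ) (𝔼 em rewardY) ε (𝔼 em maxX))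
      (+-nonNegative
        (0≤y-x (𝔼-tail-comparison (q * q) (reward-measurable mZ τ σ) (reward-measurable mY τ σ) (*-positive 0<q 0<q) finite-rewardZ
          (reward-tail-comparison q (<⇒≤ 0<q) (x-y≤x 0≤ε) refl)))
        (+-nonNegative (*-nonNegative (*-nonNegative 0≤ε 0≤ε) (𝔼-nonNegative rewardY))
          (*-nonNegative (+-nonNegative 0≤1 0≤1) (*-nonNegative 0≤ε (0≤y-x 𝔼rewardY≤𝔼max))))))
      where
      q = 1# - ε
      0<q : 0# < q
      0<q = 0<y-x (≰⇒> 1≰ε)

open import Level using (suc)

proposition1p7 : (em : ExcludedMiddle (suc 0ℓ)) (R : RealField) → let open Real R in
    ∃ λ (K : ℝ) → (0# < K) ×
    (∀ (n : ℕ) (I : Instance n) → IsInstance I →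
    (s : ℕ) → 1 ℕ.≤ s → (s≤n : s ℕ.≤ n) →
    (G : ℝ → ℝ) → (∀ x → IsRoot s (productFirst s s≤n I x) (G x)) →
    n ℕ.≤ 2 ℕ.* s →
    (ε √n : ℝ) → IsRoot 2 (fromℕ n) √n → √n ⁻¹ < ε →
    (∀ (i : Fin n) → toℕ i ℕ.< s → Small ε (I i)) →
    (τ : Vector ℝ n) → (∀ t → 0# ≤ τ t) → (σ : Permutation′ n) →
    (P : ProbabilitySpace) → let open Probability P in
    (X Y Z : Vector (Ω → ℝ) n) (ρ : Ω → Permutation′ n) →
    IsDraw ℙ I X →
    IsDraw ℙ (replaceFirst s G I) Y →
    IsUniformOnFirst s ρ → Independent X ρ →
    IsReorderedDraw I ρ Z →
    FiniteExpectation (λ ω → maximum (λ i → X i ω)) →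
    𝔼 em (λ ω → reward τ σ (λ i → Y i ω))
    - K * ε * 𝔼 em (λ ω → maximum (λ i → X i ω))
    ≤ 𝔼 em (λ ω → reward τ σ (λ i → Z i ω)))
proposition1p7 em R = 1# + 1# , 0<2 , λ where
    -- As `1 ≤ s ≤ n`, both numbers are successors; the predecessor named `s` here is the largest
    -- shuffled index.
    (ℕ.suc m) I cdfs (ℕ.suc s) 1≤s s≤n G root _ ε √n _ _ small τ 0≤τ σ P X Y Z ρ drawX drawY uniform _ drawZ finite →
      Comparison.reward-comparison em R P I cdfs s s≤n G root ε small τ 0≤τ σ X Y Z ρ drawX drawY uniform drawZ finite
  where
  open OrderedField R
  0<2 : 0# < 1# + 1#
  0<2 = <-≤-trans 0<1 (≤-respˡ-≈ (+-identityʳ 1#) (+-monoʳ-≤ 1# 0≤1))
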